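{- Let $G$ be a finitely generated abelian group. Then the following are equivalent: (i) $G$ has a connected Cayley graph that is not CCA; (ii) $G$ has a connected Cayley graph that is not strongly CCA; (iii) $G$ has a direct summand isomorphic to $\mathbb{Z}_4 \oplus \mathbb{Z}_2$ or to $\mathbb{Z}_{2^n} \oplus \mathbb{Z}_2 \oplus \mathbb{Z}_2$ for some $n \ge 3$.
   Context: Groups are abelian, written additively; $\mathbb{Z}_n$ is the cyclic group of order $n$. A Cayley graph of $G$ is a graph $\operatorname{Cay}(G;S)$, where $S$ is a subset of $G$ with $S = -S$ ($S$ is not required to be finite): it is the undirected graph whose vertices are the elements of $G$, with an edge joining $g$ and $g+s$ for all $g \in G$ and $s \in S$. (It is connected if and only if $S$ generates $G$.) An automorphism $\varphi$ of $\operatorname{Cay}(G;S)$ is colour-preserving if $\varphi(g+s) \in \{\varphi(g) \pm s\}$ for all $g \in G$ and $s \in S$. An automorphism $\varphi$ of $\operatorname{Cay}(G;S)$ is colour-permuting if there is a bijection $\pi \colon S \to S$ such that $\varphi(g+s) \in \{\varphi(g) \pm \pi(s)\}$ for all $g \in G$ and $s \in S$. A bijection $\varphi \colon G \to G$ is affine if there are a group automorphism $\tau$ of $G$ and an element $b \in G$ such that $\varphi(x) = \tau(x) + b$ for all $x \in G$. The graph $\operatorname{Cay}(G;S)$ is CCA if every colour-preserving automorphism of it is affine, and strongly CCA if every colour-permuting automorphism of it is affine. -}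

module Defs where

open import Algebra.Bundles using (AbelianGroup)
open import Algebra.Construct.DirectProduct using () renaming (abelianGroup to directProduct)
open import Algebra.Morphism.Structures using (module GroupMorphisms)
open import Data.Integer.Base as ℤ using (ℤ; +_)
open import Data.Integer.Divisibility.Signed using (_∣_; divides; ∣m∣n⇒∣m+n; ∣m⇒∣-m)
import Data.Integer.Properties as ℤₚ
open import Data.Integer.Tactic.RingSolver using (solve-∀)
open import Data.List.Base using (List)
import Data.List.Membership.Setoid as Membership
open import Data.Nat.Base using (ℕ)
open import Data.Product.Base using (Σ; ∃-syntax; Σ-syntax; _×_; _,_; proj₁; proj₂)
open import Data.Sum.Base using (_⊎_)
open import Function.Bundles using (Bijection; _⇔_)
open import Level using (Level; _⊔_; suc; 0ℓ)
open import Relation.Binary.Bundles using (Setoid)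
open import Relation.Binary.Construct.Closure.ReflexiveTransitive using (Star)
import Relation.Binary.Construct.On as On
open import Relation.Binary.Core using (Rel)
open import Relation.Binary.Definitions using (Symmetric; _Respects_; _Respects₂_)
open import Relation.Binary.PropositionalEquality.Core using (_≡_; refl; subst)
import Relation.Binary.Reasoning.Setoid as SetoidReasoning
open import Relation.Unary using (Pred; _∈_)

private
  variable
    a b c ℓ ℓ₁ ℓ₂ v e : Level

infix 4 _≅_

_≅_ : AbelianGroup a ℓ₁ → AbelianGroup b ℓ₂ → Set (a ⊔ b ⊔ ℓ₁ ⊔ ℓ₂)
G ≅ H = ∃[ f ] IsGroupIsomorphism f
  where open GroupMorphisms (AbelianGroup.rawGroup G) (AbelianGroup.rawGroup H)

infixr 6 _⊕_

_⊕_ : AbelianGroup a ℓ₁ → AbelianGroup b ℓ₂ → AbelianGroup (a ⊔ b) (ℓ₁ ⊔ ℓ₂)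
_⊕_ = directProduct

-- The cyclic group of order n, as the integers with congruence modulo n
-- for equality.  (n = 0 gives the infinite cyclic group.)

ℤ/_ : ℕ → AbelianGroup 0ℓ 0ℓ
ℤ/ n = record
  { Carrier        = ℤ
  ; _≈_            = _≈_
  ; _∙_            = ℤ._+_
  ; ε              = ℤ.0ℤ
  ; _⁻¹            = ℤ.-_
  ; isAbelianGroup = record
    { isGroup = record
      { isMonoid = record
        { isSemigroup = record
          { isMagma = record
            { isEquivalence = record
              { refl  = λ {x} → ≡⇒≈ {x} refl
              ; sym   = λ {x} {y} p → subst (+ n ∣_) (neg-diff x y) (∣m⇒∣-m p)
              ; trans = λ {x} {y} {z} p q →
                  subst (+ n ∣_) (add-diff x y z) (∣m∣n⇒∣m+n p q)
              }
            ; ∙-cong = λ {x} {y} {u} {w} p q →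
                subst (+ n ∣_) (diff-add x y u w) (∣m∣n⇒∣m+n p q)
            }
          ; assoc = λ x y z → ≡⇒≈ (ℤₚ.+-assoc x y z)
          }
        ; identity = (λ x → ≡⇒≈ (ℤₚ.+-identityˡ x)) , (λ x → ≡⇒≈ (ℤₚ.+-identityʳ x))
        }
      ; inverse = (λ x → ≡⇒≈ (ℤₚ.+-inverseˡ x)) , (λ x → ≡⇒≈ (ℤₚ.+-inverseʳ x))
      ; ⁻¹-cong = λ {x} {y} p → subst (+ n ∣_) (diff-neg x y) (∣m⇒∣-m p)
      }
    ; comm = λ x y → ≡⇒≈ (ℤₚ.+-comm x y)
    }
  }
  where
  _≈_ : Rel ℤ 0ℓ
  x ≈ y = + n ∣ (x ℤ.- y)

  ≡⇒≈ : ∀ {x y} → x ≡ y → x ≈ y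
  ≡⇒≈ {x} refl = divides ℤ.0ℤ (ℤₚ.+-inverseʳ x)

  neg-diff : ∀ x y → ℤ.- (x ℤ.- y) ≡ y ℤ.- x
  neg-diff = solve-∀

  add-diff : ∀ x y z → (x ℤ.- y) ℤ.+ (y ℤ.- z) ≡ x ℤ.- z
  add-diff = solve-∀

  diff-add : ∀ x y u w → (x ℤ.- y) ℤ.+ (u ℤ.- w) ≡ (x ℤ.+ u) ℤ.- (y ℤ.+ w)
  diff-add = solve-∀

  diff-neg : ∀ x y → ℤ.- (x ℤ.- y) ≡ (ℤ.- x) ℤ.- (ℤ.- y)
  diff-neg = solve-∀

-- Subsets of a group G : AbelianGroup c ℓ are ≈-respecting predicates with
-- values in Set (c ⊔ ℓ), a level closed under generating subgroups.

module _ (G : AbelianGroup c ℓ) where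

  open AbelianGroup G using (Carrier; _≈_; setoid)
    renaming (_∙_ to _+_; ε to 0#; _⁻¹ to -_)
  open Membership setoid using () renaming (_∈_ to _∈ₗ_)

  data Generated (X : Pred Carrier (c ⊔ ℓ)) : Pred Carrier (c ⊔ ℓ) where
    generator : ∀ {x} → x ∈ X → Generated X x
    zero      : Generated X 0#
    add       : ∀ {x y} → Generated X x → Generated X y → Generated X (x + y)
    neg       : ∀ {x} → Generated X x → Generated X (- x)
    respects  : ∀ {x y} → x ≈ y → Generated X x → Generated X y

  FinitelyGenerated : Set (c ⊔ ℓ)
  FinitelyGenerated = ∃[ xs ] (∀ x → x ∈ Generated (_∈ₗ xs))

  record Subgroup : Set (suc (c ⊔ ℓ)) where
    field
      Member     : Pred Carrier (c ⊔ ℓ)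
      resp       : Member Respects _≈_
      0∈         : 0# ∈ Member
      +-closed   : ∀ {x y} → x ∈ Member → y ∈ Member → (x + y) ∈ Member
      neg-closed : ∀ {x} → x ∈ Member → (- x) ∈ Member

    abelianGroup : AbelianGroup (c ⊔ ℓ) ℓ
    abelianGroup = record
      { Carrier        = Σ Carrier Member
      ; _≈_            = λ x y → proj₁ x ≈ proj₁ y
      ; _∙_            = λ x y → proj₁ x + proj₁ y , +-closed (proj₂ x) (proj₂ y)
      ; ε              = 0# , 0∈
      ; _⁻¹            = λ x → - proj₁ x , neg-closed (proj₂ x)
      ; isAbelianGroup = record
        { isGroup = record
          { isMonoid = record
            { isSemigroup = record
              { isMagma = record
                { isEquivalence = On.isEquivalence proj₁ G.isEquivalence
                ; ∙-cong        = G.∙-cong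
                }
              ; assoc = λ x y z → G.assoc (proj₁ x) (proj₁ y) (proj₁ z)
              }
            ; identity = (λ x → G.identityˡ (proj₁ x)) , (λ x → G.identityʳ (proj₁ x))
            }
          ; inverse = (λ x → G.inverseˡ (proj₁ x)) , (λ x → G.inverseʳ (proj₁ x))
          ; ⁻¹-cong = G.⁻¹-cong
          }
        ; comm = λ x y → G.comm (proj₁ x) (proj₁ y)
        }
      }
      where module G = AbelianGroup G

  IsDirectSummand : Subgroup → Set (suc (c ⊔ ℓ))
  IsDirectSummand H = ∃[ K ]
      (∀ x → ∃[ h ] ∃[ k ] (h ∈ Member H × k ∈ Member K × x ≈ h + k))
    × (∀ x → x ∈ Member H → x ∈ Member K → x ≈ 0#)
    where open Subgroup

  HasDirectSummandIsomorphicTo : AbelianGroup a ℓ₁ → Set (suc (c ⊔ ℓ) ⊔ a ⊔ ℓ₁)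
  HasDirectSummandIsomorphicTo A =
    ∃[ H ] (IsDirectSummand H × Subgroup.abelianGroup H ≅ A)

-- Undirected; loops are allowed.

record Graph v ℓ e : Set (suc (v ⊔ ℓ ⊔ e)) where
  field
    vertices : Setoid v ℓ
  open Setoid vertices using (_≈_) renaming (Carrier to Vertex) public
  field
    Adjacent : Rel Vertex e
    adj-resp : Adjacent Respects₂ _≈_
    adj-sym  : Symmetric Adjacent

-- Walks of length zero join ≡-equal vertices only, so the end point of the
-- walk is allowed to vary up to ≈.

Connected : Graph v ℓ e → Set (v ⊔ ℓ ⊔ e)
Connected Γ = ∀ g h → ∃[ h′ ] (Star Adjacent g h′ × h′ ≈ h)
  where open Graph Γ

record Automorphism (Γ : Graph v ℓ e) : Set (v ⊔ ℓ ⊔ e) where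
  open Graph Γ
  field
    bijection : Bijection vertices vertices
  open Bijection bijection using (to) public
  field
    adjacency : ∀ g h → Adjacent g h ⇔ Adjacent (to g) (to h)

module _ (G : AbelianGroup c ℓ) where

  open AbelianGroup G using (Carrier; _≈_; setoid; rawGroup)
    renaming (_∙_ to _+_; _⁻¹ to -_)
  open GroupMorphisms rawGroup rawGroup using (IsGroupIsomorphism)

  record ConnectionSet : Set (suc (c ⊔ ℓ)) where
    field
      Member     : Pred Carrier (c ⊔ ℓ)
      resp       : Member Respects _≈_
      neg-closed : ∀ {s} → s ∈ Member → (- s) ∈ Member

    elements : Setoid (c ⊔ ℓ) ℓ
    elements = On.setoid setoid (proj₁ {B = Member})

  Cay : ConnectionSet → Graph c ℓ (c ⊔ ℓ)
  Cay S = record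
    { vertices = setoid
    ; Adjacent = λ g h → ∃[ s ] (s ∈ Member × h ≈ g + s)
    ; adj-resp = (λ h≈h′ (s , s∈S , h≈g+s) → s , s∈S , G.trans (G.sym h≈h′) h≈g+s)
               , (λ g≈g′ (s , s∈S , h≈g+s) → s , s∈S , G.trans h≈g+s (G.∙-congʳ g≈g′))
    ; adj-sym  = λ (s , s∈S , h≈g+s) → - s , neg-closed s∈S , flip h≈g+s
    }
    where
    open ConnectionSet S
    module G = AbelianGroup G
    open SetoidReasoning setoid

    flip : ∀ {g h s} → h ≈ g + s → g ≈ h + (- s)
    flip {g} {h} {s} h≈g+s = begin
      g               ≈⟨ G.identityʳ g ⟨
      g + G.ε         ≈⟨ G.∙-congˡ (G.inverseʳ s) ⟨
      g + (s + (- s)) ≈⟨ G.assoc g s (- s) ⟨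
      (g + s) + (- s) ≈⟨ G.∙-congʳ h≈g+s ⟨
      h + (- s)       ∎

  infix 4 _∈[_±_]

  _∈[_±_] : Carrier → Carrier → Carrier → Set ℓ
  x ∈[ y ± s ] = x ≈ y + s ⊎ x ≈ y + (- s)

  Affine : (Carrier → Carrier) → Set (c ⊔ ℓ)
  Affine φ = ∃[ τ ] ∃[ b ] (IsGroupIsomorphism τ × (∀ x → φ x ≈ τ x + b))

  module _ (S : ConnectionSet) (φ : Automorphism (Cay S)) where

    open ConnectionSet S
    open Automorphism φ

    ColourPreserving : Set (c ⊔ ℓ)
    ColourPreserving = ∀ g s → s ∈ Member → to (g + s) ∈[ to g ± s ]

    -- π is not required to commute with negation.

    ColourPermuting : Set (c ⊔ ℓ)
    ColourPermuting = Σ[ π ∈ Bijection elements elements ]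
      (∀ g s → to (g + proj₁ s) ∈[ to g ± proj₁ (Bijection.to π s) ])

  CCA : ConnectionSet → Set (c ⊔ ℓ)
  CCA S = ∀ φ → ColourPreserving S φ → Affine (Automorphism.to φ)

  StronglyCCA : ConnectionSet → Set (c ⊔ ℓ)
  StronglyCCA S = ∀ φ → ColourPermuting S φ → Affine (Automorphism.to φ)

{-# OPTIONS --safe #-}

-- Let φ permute the colours, and write Δ s g = φ (g + s) - φ g = ± π s.  Comparing the
-- two ways around the square g, g + s, g + t, g + s + t shows that Δ s changes along t
-- only if 2s = 2t has order two.  The x for which Δ x is constant form a subgroup L ⊇ 2G,
-- and if φ is not affine, then a change along some pair s, t occurs; s and t are then
-- independent in the elementary abelian group G / L.  Hence there are characters
-- α, β : G → ℤ/2 dual to s, t, with 2s = 2t = z of order two (an "obstruction").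
-- Conversely x ↦ x + α(x) β(x) z preserves the colours of {x ∣ 2x = z} ∪ (ker α ∩ ker β)
-- and is not affine.
--
-- Given an obstruction, write z = 2ⁿ w with n as large as possible; then ⟨ w ⟩ has order
-- 2ⁿ⁺¹ and a complement.  If n = 1, take w = t, and ⟨ t ⟩ ⊕ ⟨ s - t ⟩ is a summand.  If
-- n ≥ 2, then s - 2ⁿ⁻¹ w and t - 2ⁿ⁻¹ w are involutions dual to α, β, and w can be moved
-- into ker α ∩ ker β, which gives the summand ℤ/2ⁿ⁺¹ ⊕ ℤ/2 ⊕ ℤ/2.
module Submission where

open import Defs
open import Algebra.Bundles using (AbelianGroup)
open import Algebra.Morphism.Construct.Composition using (isMagmaHomomorphism)
open import Algebra.Morphism.Structures using (module GroupMorphisms; module MagmaMorphisms)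
import Algebra.Properties.AbelianGroup as AbelianGroupProperties
import Algebra.Properties.CommutativeMonoid.Mult as CommutativeMonoidMult
open import Axiom.ExcludedMiddle using (ExcludedMiddle)
open import Data.Fin.Base using (Fin; zero; suc; toℕ)
open import Data.Fin.Properties using (pigeonhole)
open import Data.Integer.Base as ℤ using (ℤ; +_; -[1+_])
open import Data.Integer.Divisibility.Signed using (_∣_; divides; ∣-trans; ∣⇒∣ᵤ)
import Data.Integer.DivMod as ℤ
import Data.Integer.Properties as ℤ
open import Data.Integer.Tactic.RingSolver using (solve-∀)
open import Data.List.Base as List using (List; []; _∷_; _++_; cartesianProductWith; length; map; upTo)
open import Data.List.Membership.Propositional using () renaming (_∈_ to _∈ₗ_)
open import Data.List.Membership.Propositional.Properties using (∈-cartesianProductWith⁺; ∈-upTo⁺)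
open import Data.List.Relation.Unary.All as All using (All; []; _∷_)
open import Data.List.Relation.Unary.Any as Any using (Any; here; there)
import Data.List.Relation.Unary.Any.Properties as Any
open import Data.Nat.Base as ℕ using (ℕ; zero; suc; _≤_; _^_)
import Data.Nat.Divisibility as ℕ
open import Data.Nat.Induction using (<-wellFounded)
import Data.Nat.Properties as ℕ
import Data.Nat.Tactic.RingSolver as ℕ
open import Data.Product.Base using (Σ-syntax; ∃-syntax; _×_; _,_; proj₁; proj₂)
open import Data.Sum.Base using (_⊎_; inj₁; inj₂; fromInj₁)
open import Data.Vec.Base as Vec using (Vec; []; _∷_)
open import Function.Bundles using (Bijection; _⇔_; mk⇔)
import Function.Construct.Identity as Identity
open import Induction.WellFounded using (Acc; acc)
open import Level using (Level; _⊔_; Lift; lift; 0ℓ)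
open import Relation.Binary.Construct.Closure.ReflexiveTransitive using (Star; ε; _◅_)
open import Relation.Binary.PropositionalEquality.Core as ≡ using (_≡_)
import Relation.Binary.Reasoning.Setoid as SetoidReasoning
import Relation.Binary.Reflection as Reflection
open import Relation.Nullary.Decidable.Core using (Dec; yes; no)
open import Relation.Nullary.Negation.Core using (¬_; contradiction)

-- A sign change of Δ s only shows 2 π(s) ≠ 0, while the obstruction needs 2s ≠ 0. Here π is an
-- arbitrary bijection of a possibly infinite set of colours. That 2 π(s) = 0 forces 2s = 0 is
-- direct; the converse is a counting argument, which works because a finitely generated abelian
-- group has only finitely many involutions.
--
-- The characters and the complements of cyclic subgroups come from one source: a subgroup K that is
-- maximal subject to avoiding a given element. If K contains mG for some m > 0, only the finitely
-- many cosets of mG matter, so K is found by a finite search.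
--
-- The two kinds of summand differ because correcting s and t by 2ⁿ⁻¹ w must not alter their values
-- under α and β. For n ≥ 2 the correction lies in 2G, where both characters vanish. For n = 1 it
-- need not; with w = t, the correction of t is zero, and only one involution s - t remains. The
-- case n = 0 does not occur, since z = 2s.

private
  variable
    c ℓ : Level

-- Integer multiples in an abelian group, and a solver for its identities.

module IntegerMultiples (G : AbelianGroup c ℓ) where

  open AbelianGroup G renaming (_∙_ to infixl 6 _+_; ε to 0#; _⁻¹ to -_)
  open AbelianGroupProperties G
  open CommutativeMonoidMult commutativeMonoid using ()
    renaming (_×_ to _×ℕ_; ×-congʳ to ×ℕ-congʳ; ×-homo-+ to ×ℕ-homo-+; ×-distrib-+ to ×ℕ-distrib-+)
  open SetoidReasoning setoid

  infixr 7 _·_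

  _·_ : ℤ → Carrier → Carrier
  (+ n)    · x = n ×ℕ x
  -[1+ n ] · x = - (suc n ×ℕ x)

  ·-congˡ : ∀ k {x y} → x ≈ y → k · x ≈ k · y
  ·-congˡ (+ n)    x≈y = ×ℕ-congʳ n x≈y
  ·-congˡ -[1+ n ] x≈y = ⁻¹-cong (×ℕ-congʳ (suc n) x≈y)

  ·-congʳ : ∀ {j k} x → j ≡ k → j · x ≈ k · x
  ·-congʳ x ≡.refl = refl

  1· : ∀ x → (+ 1) · x ≈ x
  1· = identityʳ

  private
    neg-pos : ∀ n x → (ℤ.- + n) · x ≈ - (n ×ℕ x)
    neg-pos zero    x = sym ε⁻¹≈ε
    neg-pos (suc n) x = refl

    cancel-common : ∀ x y z → (x + y) - (x + z) ≈ y - z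
    cancel-common x y z = begin
      (x + y) - (x + z)       ≈⟨ ∙-congˡ (⁻¹-∙-comm x z) ⟨
      (x + y) + (- x - z)     ≈⟨ assoc (x + y) (- x) (- z) ⟨
      ((x + y) - x) - z       ≈⟨ ∙-congʳ (xyx⁻¹≈y x y) ⟩
      y - z                   ∎

    ⊖-· : ∀ m n x → (m ℤ.⊖ n) · x ≈ m ×ℕ x - n ×ℕ x
    ⊖-· m zero x = begin
      (m ℤ.⊖ 0) · x  ≈⟨ ·-congʳ x (ℤ.⊖-≥ {m} {0} ℕ.z≤n) ⟩
      m ×ℕ x         ≈⟨ identityʳ _ ⟨
      m ×ℕ x + 0#    ≈⟨ ∙-congˡ ε⁻¹≈ε ⟨
      m ×ℕ x - 0#    ∎
    ⊖-· zero (suc n) x = sym (identityˡ _)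
    ⊖-· (suc m) (suc n) x = begin
      (suc m ℤ.⊖ suc n) · x   ≈⟨ ·-congʳ x (ℤ.[1+m]⊖[1+n]≡m⊖n m n) ⟩
      (m ℤ.⊖ n) · x           ≈⟨ ⊖-· m n x ⟩
      m ×ℕ x - n ×ℕ x         ≈⟨ cancel-common x (m ×ℕ x) (n ×ℕ x) ⟨
      suc m ×ℕ x - suc n ×ℕ x ∎

  ·-distribʳ-+ : ∀ j k x → (j ℤ.+ k) · x ≈ j · x + k · x
  ·-distribʳ-+ (+ m)    (+ n)    x = ×ℕ-homo-+ x m n
  ·-distribʳ-+ (+ m)    -[1+ n ] x = ⊖-· m (suc n) x
  ·-distribʳ-+ -[1+ m ] (+ n)    x = trans (⊖-· n (suc m) x) (comm _ _)
  ·-distribʳ-+ -[1+ m ] -[1+ n ] x = begin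
    - (suc (suc (m ℕ.+ n)) ×ℕ x)       ≈⟨ ⁻¹-cong (∙-congˡ (×ℕ-homo-+ x (suc m) n)) ⟩
    - (x + (suc m ×ℕ x + n ×ℕ x))      ≈⟨ ⁻¹-cong (assoc x (suc m ×ℕ x) (n ×ℕ x)) ⟨
    - ((x + suc m ×ℕ x) + n ×ℕ x)      ≈⟨ ⁻¹-cong (∙-congʳ (comm x (suc m ×ℕ x))) ⟩
    - ((suc m ×ℕ x + x) + n ×ℕ x)      ≈⟨ ⁻¹-cong (assoc (suc m ×ℕ x) x (n ×ℕ x)) ⟩
    - (suc m ×ℕ x + suc n ×ℕ x)        ≈⟨ ⁻¹-∙-comm _ _ ⟨
    - (suc m ×ℕ x) - (suc n ×ℕ x)      ∎

  ·-distribˡ-+ : ∀ k x y → k · (x + y) ≈ k · x + k · y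
  ·-distribˡ-+ (+ n)    x y = ×ℕ-distrib-+ x y n
  ·-distribˡ-+ -[1+ n ] x y = trans (⁻¹-cong (×ℕ-distrib-+ x y (suc n))) (sym (⁻¹-∙-comm _ _))

  ·-zeroʳ : ∀ k → k · 0# ≈ 0#
  ·-zeroʳ k = identityˡ-unique (k · 0#) (k · 0#)
    (trans (sym (·-distribˡ-+ k 0# 0#)) (·-congˡ k (identityˡ 0#)))

  ·-negʳ : ∀ k x → k · (- x) ≈ - (k · x)
  ·-negʳ k x = inverseˡ-unique _ _ (begin
    k · (- x) + k · x ≈⟨ ·-distribˡ-+ k (- x) x ⟨
    k · (- x + x)     ≈⟨ ·-congˡ k (inverseˡ x) ⟩
    k · 0#            ≈⟨ ·-zeroʳ k ⟩
    0#                ∎)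

  ·-negˡ : ∀ k x → (ℤ.- k) · x ≈ - (k · x)
  ·-negˡ k x = inverseˡ-unique _ _ (begin
    (ℤ.- k) · x + k · x ≈⟨ ·-distribʳ-+ (ℤ.- k) k x ⟨
    (ℤ.- k ℤ.+ k) · x   ≈⟨ ·-congʳ x (ℤ.+-inverseˡ k) ⟩
    0#                  ∎)

  private
    ×ℕ-·-assoc : ∀ n k x → (+ n ℤ.* k) · x ≈ n ×ℕ (k · x)
    ×ℕ-·-assoc zero    k x = refl
    ×ℕ-·-assoc (suc n) k x = begin
      (+ suc n ℤ.* k) · x       ≈⟨ ·-congʳ x (ℤ.suc-* (+ n) k) ⟩
      (k ℤ.+ + n ℤ.* k) · x     ≈⟨ ·-distribʳ-+ k (+ n ℤ.* k) x ⟩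
      k · x + (+ n ℤ.* k) · x   ≈⟨ ∙-congˡ (×ℕ-·-assoc n k x) ⟩
      k · x + n ×ℕ (k · x)      ∎

  ·-assoc : ∀ j k x → (j ℤ.* k) · x ≈ j · k · x
  ·-assoc (+ n)    k x = ×ℕ-·-assoc n k x
  ·-assoc -[1+ n ] k x = begin
    (-[1+ n ] ℤ.* k) · x        ≈⟨ ·-congʳ x (ℤ.neg-distribˡ-* (+ suc n) k) ⟨
    (ℤ.- (+ suc n ℤ.* k)) · x   ≈⟨ ·-negˡ (+ suc n ℤ.* k) x ⟩
    - ((+ suc n ℤ.* k) · x)     ≈⟨ ⁻¹-cong (×ℕ-·-assoc (suc n) k x) ⟩
    - (suc n ×ℕ (k · x))        ∎

  infixl 6 _⊞_
  infix  8 ⊟_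

  -- Syntax for proofs by reflection: a term is normalised to its vector of integer coefficients, so
  -- formally equal terms become the same linear combination by computation.
  data Expr (n : ℕ) : Set where
    var : Fin n → Expr n
    𝟘   : Expr n
    _⊞_ : Expr n → Expr n → Expr n
    ⊟_  : Expr n → Expr n

  private
    ⟦_⟧ : ∀ {n} → Expr n → Vec Carrier n → Carrier
    ⟦ var i ⟧ ρ = Vec.lookup ρ i
    ⟦ 𝟘 ⟧     ρ = 0#
    ⟦ e ⊞ f ⟧ ρ = ⟦ e ⟧ ρ + ⟦ f ⟧ ρ
    ⟦ ⊟ e ⟧   ρ = - ⟦ e ⟧ ρ

    unit : ∀ {n} → Fin n → Vec ℤ n
    unit zero    = + 1 ∷ Vec.replicate _ (+ 0)
    unit (suc i) = + 0 ∷ unit i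

    coefficients : ∀ {n} → Expr n → Vec ℤ n
    coefficients (var i) = unit i
    coefficients 𝟘       = Vec.replicate _ (+ 0)
    coefficients (e ⊞ f) = Vec.zipWith ℤ._+_ (coefficients e) (coefficients f)
    coefficients (⊟ e)   = Vec.map ℤ.-_ (coefficients e)

    combine : ∀ {n} → Vec ℤ n → Vec Carrier n → Carrier
    combine []       []      = 0#
    combine (k ∷ ks) (x ∷ ρ) = k · x + combine ks ρ

    ⟦_⇓⟧ : ∀ {n} → Expr n → Vec Carrier n → Carrier
    ⟦ e ⇓⟧ = combine (coefficients e)

    combine-0 : ∀ {n} (ρ : Vec Carrier n) → combine (Vec.replicate n (+ 0)) ρ ≈ 0#
    combine-0 []      = refl
    combine-0 (x ∷ ρ) = trans (identityˡ _) (combine-0 ρ)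

    combine-unit : ∀ {n} (i : Fin n) ρ → combine (unit i) ρ ≈ Vec.lookup ρ i
    combine-unit zero    (x ∷ ρ) = trans (∙-cong (1· x) (combine-0 ρ)) (identityʳ x)
    combine-unit (suc i) (x ∷ ρ) = trans (identityˡ _) (combine-unit i ρ)

    combine-+ : ∀ {n} (js ks : Vec ℤ n) ρ →
                combine (Vec.zipWith ℤ._+_ js ks) ρ ≈ combine js ρ + combine ks ρ
    combine-+ []       []       []      = sym (identityʳ 0#)
    combine-+ (j ∷ js) (k ∷ ks) (x ∷ ρ) = begin
      (j ℤ.+ k) · x + combine (Vec.zipWith ℤ._+_ js ks) ρ ≈⟨ ∙-cong (·-distribʳ-+ j k x) (combine-+ js ks ρ) ⟩
      (j · x + k · x) + (combine js ρ + combine ks ρ)     ≈⟨ assoc _ _ _ ⟩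
      j · x + (k · x + (combine js ρ + combine ks ρ))     ≈⟨ ∙-congˡ (assoc _ _ _) ⟨
      j · x + ((k · x + combine js ρ) + combine ks ρ)     ≈⟨ ∙-congˡ (∙-congʳ (comm _ _)) ⟩
      j · x + ((combine js ρ + k · x) + combine ks ρ)     ≈⟨ ∙-congˡ (assoc _ _ _) ⟩
      j · x + (combine js ρ + (k · x + combine ks ρ))     ≈⟨ assoc _ _ _ ⟨
      (j · x + combine js ρ) + (k · x + combine ks ρ)     ∎

    combine-neg : ∀ {n} (ks : Vec ℤ n) ρ → combine (Vec.map ℤ.-_ ks) ρ ≈ - combine ks ρ
    combine-neg []       []      = sym ε⁻¹≈ε
    combine-neg (k ∷ ks) (x ∷ ρ) = trans (∙-cong (·-negˡ k x) (combine-neg ks ρ)) (⁻¹-∙-comm _ _)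

    correct : ∀ {n} (e : Expr n) ρ → ⟦ e ⇓⟧ ρ ≈ ⟦ e ⟧ ρ
    correct (var i) ρ = combine-unit i ρ
    correct 𝟘       ρ = combine-0 ρ
    correct (e ⊞ f) ρ = trans (combine-+ (coefficients e) (coefficients f) ρ) (∙-cong (correct e ρ) (correct f ρ))
    correct (⊟ e)   ρ = trans (combine-neg (coefficients e) ρ) (⁻¹-cong (correct e ρ))

  open Reflection setoid var ⟦_⟧ ⟦_⇓⟧ correct public using (solve; _⊜_)

  -- Together with solve: x ≈ y holds whenever x - y and l - r agree formally.
  ≈-from : ∀ {l r x y} → l ≈ r → x + r ≈ y + l → x ≈ y
  ≈-from {l} {r} {x} {y} l≈r eq = ∙-cancelʳ r x y (trans eq (∙-congˡ l≈r))

parityℕ : ∀ n → ∃[ m ] (n ≡ m ℕ.+ m ⊎ n ≡ suc (m ℕ.+ m))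
parityℕ zero = 0 , inj₁ ≡.refl
parityℕ (suc n) with parityℕ n
... | m , inj₁ n≡2m   = m , inj₂ (≡.cong suc n≡2m)
... | m , inj₂ n≡1+2m = suc m , inj₁ (≡.cong suc (≡.trans n≡1+2m (≡.sym (ℕ.+-suc m m))))

parity : ∀ k → ∃[ j ] (k ≡ j ℤ.+ j ⊎ k ≡ + 1 ℤ.+ (j ℤ.+ j))
parity (+ n) with parityℕ n
... | m , inj₁ n≡2m   = + m , inj₁ (≡.cong +_ n≡2m)
... | m , inj₂ n≡1+2m = + m , inj₂ (≡.cong +_ n≡1+2m)
parity -[1+ n ] with parityℕ n
-- The parity flips because `-[1+ n ]` stands for -(n + 1); for n = 2m this is 1 + 2(-(m + 1)).
... | m , inj₁ n≡2m   = -[1+ m ] , inj₂ (≡.cong -[1+_] n≡2m)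
... | m , inj₂ n≡1+2m = -[1+ m ] , inj₁ (≡.cong -[1+_] n≡1+2m)

-- Subgroups: intersections, multiples, spans.

module SubgroupConstructions (G : AbelianGroup c ℓ) where

  open AbelianGroup G renaming (_∙_ to infixl 6 _+_; ε to 0#; _⁻¹ to -_)
  open AbelianGroupProperties G
  open IntegerMultiples G
  open Subgroup

  infix 4 _∈_ _∉_ _⊆_

  _∈_ _∉_ : Carrier → Subgroup G → Set _
  x ∈ K = Member K x
  x ∉ K = ¬ x ∈ K

  _⊆_ : Subgroup G → Subgroup G → Set _
  J ⊆ K = ∀ {x} → x ∈ J → x ∈ K

  difference-closed : ∀ K {x y} → x ∈ K → y ∈ K → x - y ∈ K
  difference-closed K x∈K y∈K = +-closed K x∈K (neg-closed K y∈K)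

  ·-closed : ∀ K k {x} → x ∈ K → k · x ∈ K
  ·-closed K (+ n)    x∈K = ×ℕ-closed n x∈K
    where
    ×ℕ-closed : ∀ n {x} → x ∈ K → + n · x ∈ K
    ×ℕ-closed zero    x∈K = 0∈ K
    ×ℕ-closed (suc n) x∈K = +-closed K x∈K (×ℕ-closed n x∈K)
  ·-closed K -[1+ n ] {x} x∈K = neg-closed K (·-closed K (+ suc n) x∈K)

  trivial : Subgroup G
  trivial = record
    { Member     = λ x → Lift c (x ≈ 0#)
    ; resp       = λ x≈y (lift x≈0) → lift (trans (sym x≈y) x≈0)
    ; 0∈         = lift refl
    ; +-closed   = λ (lift x≈0) (lift y≈0) → lift (trans (∙-cong x≈0 y≈0) (identityˡ 0#))
    ; neg-closed = λ (lift x≈0) → lift (trans (⁻¹-cong x≈0) ε⁻¹≈ε)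
    }

  infixr 7 _∩_

  _∩_ : Subgroup G → Subgroup G → Subgroup G
  J ∩ K = record
    { Member     = λ x → x ∈ J × x ∈ K
    ; resp       = λ x≈y (x∈J , x∈K) → resp J x≈y x∈J , resp K x≈y x∈K
    ; 0∈         = 0∈ J , 0∈ K
    ; +-closed   = λ (x∈J , x∈K) (y∈J , y∈K) → +-closed J x∈J y∈J , +-closed K x∈K y∈K
    ; neg-closed = λ (x∈J , x∈K) → neg-closed J x∈J , neg-closed K x∈K
    }

  multiples : ℤ → Subgroup G
  multiples m = record
    { Member     = λ x → ∃[ y ] x ≈ m · y
    ; resp       = λ x≈x′ (y , x≈my) → y , trans (sym x≈x′) x≈my
    ; 0∈         = 0# , sym (·-zeroʳ m)
    ; +-closed   = λ (y , x≈my) (y′ , x′≈my′) → y + y′ , trans (∙-cong x≈my x′≈my′) (sym (·-distribˡ-+ m y y′))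
    ; neg-closed = λ (y , x≈my) → - y , trans (⁻¹-cong x≈my) (sym (·-negʳ m y))
    }

  -- This is K + ⟨ y ⟩. The coefficient is part of the membership proof, so that later arguments can
  -- split on its parity or its sign.
  adjoin : Subgroup G → Carrier → Subgroup G
  adjoin K y = record
    { Member     = λ x → ∃[ k ] x - k · y ∈ K
    ; resp       = λ x≈x′ (k , p) → k , resp K (∙-congʳ x≈x′) p
    ; 0∈         = + 0 , resp K (sym (inverseʳ 0#)) (0∈ K)
    ; +-closed   = λ {x} {x′} (j , p) (k , q) → j ℤ.+ k , resp K
        (trans (solve 4 (λ x x′ u v → (x ⊞ ⊟ u) ⊞ (x′ ⊞ ⊟ v) ⊜ (x ⊞ x′) ⊞ ⊟ (u ⊞ v)) refl x x′ (j · y) (k · y))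
               (∙-congˡ (⁻¹-cong (sym (·-distribʳ-+ j k y)))))
        (+-closed K p q)
    ; neg-closed = λ {x} (k , p) → ℤ.- k , resp K
        (trans (solve 2 (λ x u → ⊟ (x ⊞ ⊟ u) ⊜ ⊟ x ⊞ ⊟ (⊟ u)) refl x (k · y))
               (∙-congˡ (⁻¹-cong (sym (·-negˡ k y)))))
        (neg-closed K p)
    }

  ⊆-adjoin : ∀ K y → K ⊆ adjoin K y
  ⊆-adjoin K y {x} x∈K = + 0 , resp K (solve 1 (λ x → x ⊜ x ⊞ ⊟ 𝟘) refl x) x∈K

  ∈-adjoin : ∀ K y → y ∈ adjoin K y
  ∈-adjoin K y = + 1 , resp K (solve 1 (λ y → 𝟘 ⊜ y ⊞ ⊟ (y ⊞ 𝟘)) refl y) (0∈ K)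

  adjoin-mono : ∀ {J K} y → J ⊆ K → adjoin J y ⊆ adjoin K y
  adjoin-mono y J⊆K (k , p) = k , J⊆K p

  span : List Carrier → Subgroup G
  span []       = trivial
  span (x ∷ xs) = adjoin (span xs) x

  generated⊆ : ∀ {X} K → (∀ {x} → X x → x ∈ K) → ∀ {x} → Generated G X x → x ∈ K
  generated⊆ K X⊆K (generator x∈X)  = X⊆K x∈X
  generated⊆ K X⊆K zero             = 0∈ K
  generated⊆ K X⊆K (add p q)        = +-closed K (generated⊆ K X⊆K p) (generated⊆ K X⊆K q)
  generated⊆ K X⊆K (neg p)          = neg-closed K (generated⊆ K X⊆K p)
  generated⊆ K X⊆K (respects x≈y p) = resp K x≈y (generated⊆ K X⊆K p)

  ∈-span : ∀ {x} xs → Any (x ≈_) xs → x ∈ span xs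
  ∈-span (y ∷ ys) (here x≈y)   = resp (span (y ∷ ys)) (sym x≈y) (∈-adjoin (span ys) y)
  ∈-span (y ∷ ys) (there x∈ys) = ⊆-adjoin (span ys) y (∈-span ys x∈ys)

  spanned : FinitelyGenerated G → ∃[ xs ] (∀ x → x ∈ span xs)
  spanned (xs , gen) = xs , λ x → generated⊆ (span xs) (∈-span xs) (gen x)

  double-· : ∀ j x → (j ℤ.+ j) · x ≈ j · (x + x)
  double-· j x = trans (·-distribʳ-+ j j x) (sym (·-distribˡ-+ j x x))

  odd-expansion : ∀ j x → (+ 1 ℤ.+ (j ℤ.+ j)) · x ≈ x + j · (x + x)
  odd-expansion j x = trans (·-distribʳ-+ (+ 1) (j ℤ.+ j) x) (∙-cong (1· x) (double-· j x))

  odd-· : ∀ j {z} → z + z ≈ 0# → (+ 1 ℤ.+ (j ℤ.+ j)) · z ≈ z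
  odd-· j {z} 2z≈0 =
    trans (odd-expansion j z) (trans (∙-congˡ (trans (·-congˡ j 2z≈0) (·-zeroʳ j))) (identityʳ z))

  ·-distribˡ-- : ∀ k x y → k · (x - y) ≈ k · x - k · y
  ·-distribˡ-- k x y = trans (·-distribˡ-+ k x (- y)) (∙-congˡ (·-negʳ k y))

  ·-comm : ∀ j k x → j · k · x ≈ k · j · x
  ·-comm j k x = trans (sym (·-assoc j k x)) (trans (·-congʳ x (ℤ.*-comm j k)) (·-assoc k j x))

  2^ : ℕ → ℤ
  2^ n = + (2 ^ n)

  2^-+ : ∀ m n x → 2^ (m ℕ.+ n) · x ≈ 2^ m · 2^ n · x
  2^-+ m n x = trans (·-congʳ x (≡.trans (≡.cong +_ (ℕ.^-distribˡ-+-* 2 m n)) (ℤ.pos-* (2 ^ m) (2 ^ n))))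
                     (·-assoc (2^ m) (2^ n) x)

  2· : ∀ x → + 2 · x ≈ x + x
  2· x = ∙-congˡ (identityʳ x)

  2^-suc : ∀ n x → 2^ (suc n) · x ≈ 2^ n · (x + x)
  2^-suc n x = trans (2^-+ 1 n x) (trans (·-comm (2^ 1) (2^ n) x) (·-congˡ (2^ n) (2· x)))

-- Subgroups that are maximal subject to avoiding an element.

module SubgroupExtension (em : ∀ {a} → ExcludedMiddle a) (G : AbelianGroup c ℓ) where

  open AbelianGroup G renaming (_∙_ to infixl 6 _+_; ε to 0#; _⁻¹ to -_)
  open IntegerMultiples G
  open SubgroupConstructions G
  open Subgroup
  open SetoidReasoning setoid

  -- A greedy pass: `y` is adjoined unless this would capture `z`. By `adjoin-mono` a refusal stays
  -- justified for all later, larger subgroups, so each entry is considered once.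
  maximal-avoiding : ∀ z ys K → z ∉ K →
    ∃[ K′ ] (K ⊆ K′ × z ∉ K′ × All (λ y → y ∈ K′ ⊎ z ∈ adjoin K′ y) ys)
  maximal-avoiding z []       K z∉K = K , (λ p → p) , z∉K , []
  maximal-avoiding z (y ∷ ys) K z∉K with em {P = z ∈ adjoin K y}
  ... | yes z∈K+y with maximal-avoiding z ys K z∉K
  ...   | K′ , K⊆K′ , z∉K′ , all = K′ , K⊆K′ , z∉K′ , inj₂ (adjoin-mono {K} {K′} y K⊆K′ z∈K+y) ∷ all
  maximal-avoiding z (y ∷ ys) K z∉K | no z∉K+y with maximal-avoiding z ys (adjoin K y) z∉K+y
  ...   | K′ , K+y⊆K′ , z∉K′ , all =
    K′ , (λ p → K+y⊆K′ (⊆-adjoin K y p)) , z∉K′ , inj₁ (K+y⊆K′ (∈-adjoin K y)) ∷ all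

  representatives : ℕ → List Carrier → List Carrier
  representatives m []       = 0# ∷ []
  representatives m (x ∷ xs) = cartesianProductWith (λ j r → + j · x + r) (upTo m) (representatives m xs)

  -- Reducing the coefficients of an element modulo `m` changes it by a multiple of `m`, hence by an
  -- element of `K`.
  represent : ∀ m .{{_ : ℕ.NonZero m}} K → (∀ x → + m · x ∈ K) → ∀ xs {g} → g ∈ span xs →
              ∃[ r ] (r ∈ₗ representatives m xs × g - r ∈ K)
  represent m K mG⊆K [] {g} (lift g≈0) = 0# , here ≡.refl ,
    resp K (sym (trans (∙-congʳ g≈0) (inverseʳ 0#))) (0∈ K)
  represent m K mG⊆K (x ∷ xs) {g} (k , p) with represent m K mG⊆K xs p
  ... | r , r∈ , q = + i · x + r , ∈-cartesianProductWith⁺ (λ j r → + j · x + r) (∈-upTo⁺ (ℤ.n%ℕd<d k m)) r∈ ,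
    resp K (≈-from (sym k·x≈) (solve 5 (λ g u r v w → ((g ⊞ ⊟ u) ⊞ ⊟ r) ⊞ v ⊞ u ⊜ (g ⊞ ⊟ (w ⊞ r)) ⊞ (w ⊞ v))
                                 refl g (k · x) r ((k ℤ./ℕ m) · + m · x) (+ i · x)))
           (+-closed K q (·-closed K (k ℤ./ℕ m) (mG⊆K x)))
    where
    i = k ℤ.%ℕ m

    k·x≈ : k · x ≈ + i · x + (k ℤ./ℕ m) · + m · x
    k·x≈ = begin
      k · x                                     ≈⟨ ·-congʳ x (ℤ.a≡a%ℕn+[a/ℕn]*n k m) ⟩
      (+ i ℤ.+ (k ℤ./ℕ m) ℤ.* + m) · x          ≈⟨ ·-distribʳ-+ (+ i) ((k ℤ./ℕ m) ℤ.* + m) x ⟩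
      + i · x + ((k ℤ./ℕ m) ℤ.* + m) · x        ≈⟨ ∙-congˡ (·-assoc (k ℤ./ℕ m) (+ m) x) ⟩
      + i · x + (k ℤ./ℕ m) · + m · x            ∎

  -- For y = r + m h with r a representative, membership of y and of z in
  -- K′ + ⟨ y ⟩ only depend on r, so maximality along the representatives suffices.
  maximal : ∀ m .{{_ : ℕ.NonZero m}} xs → (∀ x → x ∈ span xs) →
    ∀ z K → z ∉ K → (∀ x → + m · x ∈ K) →
    ∃[ K′ ] (K ⊆ K′ × z ∉ K′ × (∀ y → y + y ∈ K′ → y ∈ K′ ⊎ y - z ∈ K′))
  maximal m xs all∈ z K z∉K mG⊆K with maximal-avoiding z (representatives m xs) K z∉K
  ... | K′ , K⊆K′ , z∉K′ , dichotomies = K′ , K⊆K′ , z∉K′ , dichotomy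
    where
    dichotomy : ∀ y → y + y ∈ K′ → y ∈ K′ ⊎ y - z ∈ K′
    dichotomy y 2y∈K′ with represent m K′ (λ x → K⊆K′ (mG⊆K x)) xs (all∈ y)
    ... | r , r∈ , y-r∈K′ with All.lookup dichotomies r∈
    ...   | inj₁ r∈K′ = inj₁ (resp K′ (solve 2 (λ y r → (y ⊞ ⊟ r) ⊞ r ⊜ y) refl y r) (+-closed K′ y-r∈K′ r∈K′))
    -- As y and r agree modulo `K′`, also z - k y lies in `K′`. Since 2y does too, only the parity
    -- of `k` matters: an even `k` would put z into `K′`, an odd one puts y - z there.
    ...   | inj₂ (k , z-kr∈K′) = by-parity k (resp K′
              (≈-from (sym (·-distribˡ-- k y r))
                (solve 4 (λ z u v w → ((z ⊞ ⊟ u) ⊞ ⊟ w) ⊞ w ⊜ (z ⊞ ⊟ v) ⊞ (v ⊞ ⊟ u)) refl z (k · r) (k · y) (k · (y - r))))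
              (difference-closed K′ z-kr∈K′ (·-closed K′ k y-r∈K′)))
      where
      by-parity : ∀ k → z - k · y ∈ K′ → y ∈ K′ ⊎ y - z ∈ K′
      by-parity k p with parity k
      ... | j , inj₁ ≡.refl = contradiction
        (resp K′ (≈-from (sym (double-· j y)) (solve 3 (λ z u v → ((z ⊞ ⊟ u) ⊞ v) ⊞ u ⊜ z ⊞ v) refl z ((j ℤ.+ j) · y) (j · (y + y))))
          (+-closed K′ p (·-closed K′ j 2y∈K′)))
        z∉K′
      ... | j , inj₂ ≡.refl = inj₂
        (resp K′ (≈-from (odd-expansion j y)
                   (solve 4 (λ z y u v → ⊟ ((z ⊞ ⊟ u) ⊞ v) ⊞ (y ⊞ v) ⊜ (y ⊞ ⊟ z) ⊞ u) refl z y ((+ 1 ℤ.+ (j ℤ.+ j)) · y) (j · (y + y))))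
          (neg-closed K′ (+-closed K′ p (·-closed K′ j 2y∈K′))))

i+i≡i*2 : ∀ i → i ℤ.+ i ≡ i ℤ.* + 2
i+i≡i*2 = solve-∀

-- Heights of involutions, and complements of cyclic 2-subgroups.

module CyclicSummands (em : ∀ {a} → ExcludedMiddle a) (G : AbelianGroup c ℓ) where

  open AbelianGroup G renaming (_∙_ to infixl 6 _+_; ε to 0#; _⁻¹ to -_)
  open IntegerMultiples G
  open SubgroupConstructions G
  open SubgroupExtension em G
  open Subgroup
  open SetoidReasoning setoid

  -- Factors of two are moved from `m` into `x`, each adding one to the exponent `a`. Once `m` is
  -- odd, `x` itself can be adjoined: if z = k x modulo `K`, then m z lies in `K`, and m z = z.
  avoid-from-multiple : ∀ z → z + z ≈ 0# → ∀ K → z ∉ K → ∀ x m → Acc ℕ._<_ m → 0 ℕ.< m → + m · x ∈ K →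
    ∃[ K′ ] ∃[ a ] (K ⊆ K′ × z ∉ K′ × 2^ a · x ∈ K′)
  avoid-from-multiple z 2z≈0 K z∉K x m (acc smaller) 0<m mx∈K with parityℕ m
  ... | zero , inj₁ ≡.refl with () ← 0<m
  ... | j@(suc i) , inj₁ ≡.refl
    with avoid-from-multiple z 2z≈0 K z∉K (x + x) j (smaller (ℕ.m<m+n j ℕ.z<s)) ℕ.z<s (resp K (double-· (+ j) x) mx∈K)
  ...   | K′ , a , K⊆K′ , z∉K′ , p = K′ , suc a , K⊆K′ , z∉K′ , resp K′ (sym (2^-suc a x)) p
  avoid-from-multiple z 2z≈0 K z∉K x m (acc smaller) 0<m mx∈K | j , inj₂ ≡.refl =
    adjoin K x , 0 , ⊆-adjoin K x , z∉K+x , resp (adjoin K x) (sym (1· x)) (∈-adjoin K x)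
    where
    z∉K+x : z ∉ adjoin K x
    z∉K+x (k , z-kx∈K) = z∉K (resp K
      (trans (∙-cong (·-distribˡ-- (+ m) z (k · x)) (·-comm k (+ m) x))
        (≈-from (odd-· (+ j) 2z≈0)
          (solve 3 (λ z u v → (v ⊞ ⊟ u) ⊞ u ⊞ z ⊜ z ⊞ v) refl z (+ m · k · x) (+ m · z))))
      (+-closed K (·-closed K (+ m) z-kx∈K) (·-closed K k mx∈K)))

  -- If adjoining `x` would capture `z`, then z = k x modulo `K` with k ≠ 0, and doubling shows that
  -- 2k x lies in `K`. So a positive multiple of `x` lies in `K`, where `avoid-from-multiple`
  -- starts.
  avoid : ∀ z → z + z ≈ 0# → ∀ K → z ∉ K → ∀ x → ∃[ K′ ] ∃[ a ] (K ⊆ K′ × z ∉ K′ × 2^ a · x ∈ K′)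
  avoid z 2z≈0 K z∉K x with em {P = z ∈ adjoin K x}
  ... | no z∉K+x = adjoin K x , 0 , ⊆-adjoin K x , z∉K+x , resp (adjoin K x) (sym (1· x)) (∈-adjoin K x)
  ... | yes (k , z-kx∈K) = by-sign k z-kx∈K
    where
    double∈ : ∀ {y} → z - y ∈ K → y + y ∈ K
    double∈ {y} z-y∈K = resp K
      (solve 2 (λ z y → ⊟ ((z ⊞ ⊟ y) ⊞ (z ⊞ ⊟ y)) ⊞ (z ⊞ z) ⊜ y ⊞ y) refl z y)
      (+-closed K (neg-closed K (+-closed K z-y∈K z-y∈K)) (resp K (sym 2z≈0) (0∈ K)))

    by-multiple : ∀ n → + suc n · x + + suc n · x ∈ K → ∃[ K′ ] ∃[ a ] (K ⊆ K′ × z ∉ K′ × 2^ a · x ∈ K′)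
    by-multiple n p = avoid-from-multiple z 2z≈0 K z∉K x (suc n ℕ.+ suc n) (<-wellFounded _) ℕ.z<s
      (resp K (sym (·-distribʳ-+ (+ suc n) (+ suc n) x)) p)

    by-sign : ∀ k → z - k · x ∈ K → ∃[ K′ ] ∃[ a ] (K ⊆ K′ × z ∉ K′ × 2^ a · x ∈ K′)
    by-sign (+ zero)  z-kx∈K = contradiction (resp K (solve 1 (λ z → z ⊞ ⊟ 𝟘 ⊜ z) refl z) z-kx∈K) z∉K
    by-sign (+ suc n) z-kx∈K = by-multiple n (double∈ z-kx∈K)
    by-sign -[1+ n ]  z-kx∈K = by-multiple n (resp K
      (solve 1 (λ y → ⊟ (⊟ y ⊞ ⊟ y) ⊜ y ⊞ y) refl (+ suc n · x))
      (neg-closed K (double∈ z-kx∈K)))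

  avoid-span : ∀ z → z + z ≈ 0# → ∀ xs K → z ∉ K →
    ∃[ K′ ] ∃[ a ] (K ⊆ K′ × z ∉ K′ × (∀ {g} → g ∈ span xs → 2^ a · g ∈ K′))
  avoid-span z 2z≈0 [] K z∉K = K , 0 , (λ p → p) , z∉K , λ (lift g≈0) →
    resp K (sym (trans (·-congˡ (2^ 0) g≈0) (·-zeroʳ (2^ 0)))) (0∈ K)
  avoid-span z 2z≈0 (x ∷ xs) K z∉K with avoid z 2z≈0 K z∉K x
  ... | K₁ , a , K⊆K₁ , z∉K₁ , 2^ax∈K₁ with avoid-span z 2z≈0 xs K₁ z∉K₁
  ...   | K₂ , b , K₁⊆K₂ , z∉K₂ , 2^b∈K₂ = K₂ , a ℕ.+ b , (λ p → K₁⊆K₂ (K⊆K₁ p)) , z∉K₂ , λ {g} (k , g-kx∈) →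
    resp K₂
      (begin
        2^ a · 2^ b · (g - k · x) + 2^ b · k · 2^ a · x  ≈⟨ ∙-congˡ (trans (·-congˡ (2^ b) (·-comm k (2^ a) x)) (·-comm (2^ b) (2^ a) (k · x))) ⟩
        2^ a · 2^ b · (g - k · x) + 2^ a · 2^ b · k · x  ≈⟨ ∙-cong (2^-+ a b (g - k · x)) (2^-+ a b (k · x)) ⟨
        2^ (a ℕ.+ b) · (g - k · x) + 2^ (a ℕ.+ b) · k · x ≈⟨ ·-distribˡ-+ (2^ (a ℕ.+ b)) (g - k · x) (k · x) ⟨
        2^ (a ℕ.+ b) · (g - k · x + k · x)               ≈⟨ ·-congˡ (2^ (a ℕ.+ b)) (solve 2 (λ g u → g ⊞ ⊟ u ⊞ u ⊜ g) refl g (k · x)) ⟩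
        2^ (a ℕ.+ b) · g                                 ∎)
      (+-closed K₂ (·-closed K₂ (2^ a) (2^b∈K₂ g-kx∈)) (·-closed K₂ (2^ b) (·-closed K₂ k (K₁⊆K₂ 2^ax∈K₁))))

  -- The danger is an infinite height, as in a Prüfer group. A subgroup that contains 2ᵃ G but not
  -- `z` rules this out, and finitely many generators suffice to build one.
  height : ∀ xs → (∀ x → x ∈ span xs) → ∀ z → z + z ≈ 0# → ¬ z ≈ 0# →
           ∃[ n ] (z ∈ multiples (2^ n) × z ∉ multiples (2^ (suc n)))
  height xs all∈ z 2z≈0 z≉0 with avoid-span z 2z≈0 xs trivial (λ (lift z≈0) → z≉0 z≈0)
  ... | K , a , _ , z∉K , 2^aG⊆K = descend a λ (y , z≈2^ay) → z∉K (resp K (sym z≈2^ay) (2^aG⊆K (all∈ y)))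
    where
    descend : ∀ a → z ∉ multiples (2^ a) → ∃[ n ] (z ∈ multiples (2^ n) × z ∉ multiples (2^ (suc n)))
    descend zero    z∉ = contradiction (z , sym (1· z)) z∉
    descend (suc a) z∉ with em {P = z ∈ multiples (2^ a)}
    ... | yes z∈ = a , z∈ , z∉
    ... | no z∉′ = descend a z∉′

  -- Let `K` contain 2ⁿ⁺¹ G and be maximal subject to avoiding z = 2ⁿ w. The quotient of `G` by K +
  -- ⟨ w ⟩ is killed by 2ⁿ⁺¹, so it vanishes once it is known to have no element of order two, which
  -- is `halve`. By `2^∣`, avoiding z is enough for `K` to meet ⟨ w ⟩ trivially.
  complement : ∀ xs → (∀ x → x ∈ span xs) → ∀ n w → 2^ n · w + 2^ n · w ≈ 0# → 2^ n · w ∉ multiples (2^ (suc n)) →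
               ∃[ K ] (2^ n · w ∉ K × (∀ x → x ∈ adjoin K w))
  complement xs all∈ n w 2z≈0 z∉ with maximal (2 ^ suc n) {{ℕ.m^n≢0 2 (suc n)}} xs all∈ (2^ n · w) (multiples (2^ (suc n))) z∉ (λ x → x , refl)
  ... | K , ⊆K , z∉K , dichotomy = K , z∉K , λ x → divide (suc n) x (⊆-adjoin K w (⊆K (x , refl)))
    where
    halve : ∀ {x} → x + x ∈ adjoin K w → x ∈ adjoin K w
    halve {x} (k , 2x-kw∈K) with parity k
    -- For odd `k`, multiplying 2x - k w by 2ⁿ would put k z = z into `K`, because 2ⁿ⁺¹ x is in `K`.
    ... | j , inj₂ ≡.refl = contradiction
      (resp K (begin
          2^ (suc n) · x - 2^ n · (x + x - k · w)               ≈⟨ ∙-cong (2^-suc n x) (⁻¹-cong (·-distribˡ-- (2^ n) (x + x) (k · w))) ⟩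
          2^ n · (x + x) - (2^ n · (x + x) - 2^ n · k · w)      ≈⟨ solve 2 (λ u v → u ⊞ ⊟ (u ⊞ ⊟ v) ⊜ v) refl (2^ n · (x + x)) (2^ n · k · w) ⟩
          2^ n · k · w                                          ≈⟨ ·-comm (2^ n) k w ⟩
          k · 2^ n · w                                          ≈⟨ odd-· j 2z≈0 ⟩
          2^ n · w                                              ∎)
        (difference-closed K (⊆K (x , refl)) (·-closed K (2^ n) 2x-kw∈K)))
      z∉K
    -- For k = 2j the double of x - j w is in `K`, so x - j w lies in `K` or in z + K, and z is
    -- itself a multiple of w.
    ... | j , inj₁ ≡.refl with dichotomy (x - j · w) (resp K
            (≈-from (sym (·-distribʳ-+ j j w)) (solve 3 (λ x u v → x ⊞ x ⊞ ⊟ v ⊞ v ⊜ (x ⊞ ⊟ u) ⊞ (x ⊞ ⊟ u) ⊞ (u ⊞ u)) refl x (j · w) ((j ℤ.+ j) · w))) 2x-kw∈K)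
    ...   | inj₁ x-jw∈K = j , x-jw∈K
    ...   | inj₂ x-jw-z∈K = j ℤ.+ 2^ n , resp K
            (≈-from (·-distribʳ-+ j (2^ n) w)
              (solve 4 (λ x u v z → (x ⊞ ⊟ u) ⊞ ⊟ z ⊞ (u ⊞ z) ⊜ (x ⊞ ⊟ v) ⊞ v) refl x (j · w) ((j ℤ.+ 2^ n) · w) (2^ n · w)))
            x-jw-z∈K

    divide : ∀ i x → 2^ i · x ∈ adjoin K w → x ∈ adjoin K w
    divide zero    x p = resp (adjoin K w) (1· x) p
    divide (suc i) x p = halve (divide i (x + x) (resp (adjoin K w) (2^-suc i x) p))

  private
    double-* : ∀ q a → q ℤ.* a ℤ.+ q ℤ.* a ≡ q ℤ.* (+ 2 ℤ.* a)
    double-* = solve-∀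

  -- Every nonzero subgroup of ⟨ w ⟩ contains z = 2ⁿ w. Indeed an odd `j` would give 2ⁿ j w = z in
  -- `K`; an even one is halved, with w replaced by 2w.
  2^∣ : ∀ K n w → 2^ n · w + 2^ n · w ≈ 0# → 2^ n · w ∉ K → ∀ j → j · w ∈ K → 2^ (suc n) ∣ j
  2^∣ K n w 2z≈0 z∉K j jw∈K with parity j
  2^∣ K n w 2z≈0 z∉K j jw∈K | i , inj₂ ≡.refl = contradiction
    (resp K (trans (·-comm (2^ n) j w) (odd-· i 2z≈0)) (·-closed K (2^ n) jw∈K)) z∉K
  2^∣ K zero    w 2z≈0 z∉K j jw∈K | i , inj₁ ≡.refl = divides i (i+i≡i*2 i)
  2^∣ K (suc n) w 2z≈0 z∉K j jw∈K | i , inj₁ ≡.refl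
    with 2^∣ K n (w + w) (trans (sym (∙-cong (2^-suc n w) (2^-suc n w))) 2z≈0) (λ p → z∉K (resp K (sym (2^-suc n w)) p)) i (resp K (double-· i w) jw∈K)
  ... | divides q i≡ = divides q
    (≡.trans (≡.cong₂ ℤ._+_ i≡ i≡)
    (≡.trans (double-* q (2^ (suc n))) (≡.cong (q ℤ.*_) (≡.sym (ℤ.pos-* 2 (2 ^ suc n))))))

-- Obstructions, and additive maps between groups.

module _ {c ℓ} (G : AbelianGroup c ℓ) where

  open AbelianGroup G renaming (_∙_ to infixl 6 _+_; ε to 0#; _⁻¹ to -_)
  open Subgroup

  -- The two subgroups are the kernels of homomorphisms to ℤ/2 dual to s and t.
  record Obstruction : Set (Level.suc (c ⊔ ℓ)) where
    field
      s t      : Carrier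
      2s≈2t    : s + s ≈ t + t
      2s≉0     : ¬ s + s ≈ 0#
      4s≈0     : (s + s) + (s + s) ≈ 0#
      A B      : Subgroup G
      s∉A      : ¬ Member A s
      t∈A      : Member A t
      A-cosets : ∀ g → Member A g ⊎ Member A (g - s)
      s∈B      : Member B s
      t∉B      : ¬ Member B t
      B-cosets : ∀ g → Member B g ⊎ Member B (g - t)

MagmaHomomorphism : ∀ {c ℓ c′ ℓ′} (G : AbelianGroup c ℓ) (H : AbelianGroup c′ ℓ′) →
  (AbelianGroup.Carrier G → AbelianGroup.Carrier H) → Set (c ⊔ ℓ ⊔ ℓ′)
MagmaHomomorphism G H = MagmaMorphisms.IsMagmaHomomorphism (AbelianGroup.rawMagma G) (AbelianGroup.rawMagma H)

module AdditiveMap {c ℓ c′ ℓ′} (G : AbelianGroup c ℓ) (H : AbelianGroup c′ ℓ′) {f} (f-homo : MagmaHomomorphism G H f) where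

  private
    module G = AbelianGroup G
    module H = AbelianGroup H
    module HP = AbelianGroupProperties H
  open MagmaMorphisms.IsMagmaHomomorphism f-homo public using (homo) renaming (⟦⟧-cong to cong)

  ε-homo : f G.ε H.≈ H.ε
  ε-homo = HP.identityˡ-unique (f G.ε) (f G.ε) (H.trans (H.sym (homo G.ε G.ε)) (cong (G.identityˡ G.ε)))

  ⁻¹-homo : ∀ x → f (x G.⁻¹) H.≈ f x H.⁻¹
  ⁻¹-homo x = HP.inverseˡ-unique _ _ (H.trans (H.sym (homo (x G.⁻¹) x)) (H.trans (cong (G.inverseˡ x)) ε-homo))

  -‿homo : ∀ x y → f (x G.- y) H.≈ f x H.- f y
  -‿homo x y = H.trans (homo x (y G.⁻¹)) (H.∙-congˡ (⁻¹-homo y))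

  injective : (∀ x → f x H.≈ H.ε → x G.≈ G.ε) → ∀ {x y} → f x H.≈ f y → x G.≈ y
  injective trivial-kernel {x} {y} fx≈fy = AbelianGroupProperties.x∙y⁻¹≈ε⇒x≈y G x y
    (trivial-kernel (x G.- y) (H.trans (-‿homo x y) (HP.x≈y⇒x∙y⁻¹≈ε fx≈fy)))

-- Direct summands as split embeddings.

module DirectSummands {c ℓ} (G : AbelianGroup c ℓ) (T : AbelianGroup 0ℓ 0ℓ) where

  open AbelianGroup G renaming (_∙_ to infixl 6 _+_; ε to 0#; _⁻¹ to -_)
  open AbelianGroupProperties G
  open IntegerMultiples G
  open SubgroupConstructions G
  open Subgroup
  private module T = AbelianGroup T

  -- The last hypothesis acts twice: since 0 lies in `K` it makes `ψ` injective, and it makes the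
  -- image of `ψ` meet `K` trivially.
  directSummand : ∀ {ψ} → MagmaHomomorphism T G ψ →
    ∀ K → (∀ g → ∃[ a ] g - ψ a ∈ K) → (∀ a → ψ a ∈ K → a T.≈ T.ε) →
    HasDirectSummandIsomorphicTo G T
  directSummand {ψ} ψ-homo K cover disjoint =
    image , (K , decompose , λ x (lift (a , x≈ψa)) x∈K →
      trans x≈ψa (trans (ψ.cong (disjoint a (resp K x≈ψa x∈K))) ψ.ε-homo)) ,
    preimage , record
      { isGroupMonomorphism = record
        { isGroupHomomorphism = record
          { isMonoidHomomorphism = record
            { isMagmaHomomorphism = record
              { isRelHomomorphism = record { cong = λ {x} {y} → preimage-cong x y }
              ; homo = λ x y → T.refl
              }
            ; ε-homo = T.refl
            }
          ; ⁻¹-homo = λ x → T.refl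
          }
        ; injective = λ { {x , lift (a , x≈ψa)} {y , lift (b , y≈ψb)} a≈b → trans x≈ψa (trans (ψ.cong a≈b) (sym y≈ψb)) }
        }
      ; surjective = λ a → (ψ a , lift (a , refl)) ,
          λ { {x , lift (b , x≈ψb)} x≈ψa → ψ-injective (trans (sym x≈ψb) x≈ψa) }
      }
    where
    module ψ = AdditiveMap T G ψ-homo

    ψ-injective : ∀ {a b} → ψ a ≈ ψ b → a T.≈ b
    ψ-injective = ψ.injective λ a ψa≈0 → disjoint a (resp K (sym ψa≈0) (0∈ K))

    image : Subgroup G
    image = record
      { Member     = λ x → Lift c (∃[ a ] x ≈ ψ a)
      ; resp       = λ x≈y (lift (a , x≈ψa)) → lift (a , trans (sym x≈y) x≈ψa)
      ; 0∈         = lift (T.ε , sym ψ.ε-homo)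
      ; +-closed   = λ (lift (a , x≈ψa)) (lift (b , y≈ψb)) → lift (a T.∙ b , trans (∙-cong x≈ψa y≈ψb) (sym (ψ.homo a b)))
      ; neg-closed = λ (lift (a , x≈ψa)) → lift (a T.⁻¹ , trans (⁻¹-cong x≈ψa) (sym (ψ.⁻¹-homo a)))
      }

    decompose : ∀ x → ∃[ h ] ∃[ k ] (h ∈ image × k ∈ K × x ≈ h + k)
    decompose x with cover x
    ... | a , x-ψa∈K = ψ a , x - ψ a , lift (a , refl) , x-ψa∈K ,
      solve 2 (λ x y → x ⊜ y ⊞ (x ⊞ ⊟ y)) refl x (ψ a)

    preimage : Σ[ x ∈ Carrier ] x ∈ image → T.Carrier
    preimage (x , lift (a , x≈ψa)) = a

    preimage-cong : ∀ x y → proj₁ x ≈ proj₁ y → preimage x T.≈ preimage y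
    preimage-cong (x , lift (a , x≈ψa)) (y , lift (b , y≈ψb)) x≈y = ψ-injective (trans (sym x≈ψa) (trans x≈y y≈ψb))

  -- `decompose` merely chooses a decomposition of each element. That the resulting projection
  -- respects `≈` and is additive comes from uniqueness, `part-unique`.
  retraction : HasDirectSummandIsomorphicTo G T →
    ∃[ p ] ∃[ q ] (MagmaHomomorphism G T p × MagmaHomomorphism T G q × (∀ a → p (q a) T.≈ a))
  retraction (H , (K , decompose , disjoint) , f , f-iso) = p , q ,
    record { isRelHomomorphism = record { cong = λ {x} {y} x≈y → f.⟦⟧-cong {h x} {h y} (part-unique (part∈ x) (part∈ y) (rest x) (rest y) x≈y) }
           ; homo = λ x y → T.trans (f.⟦⟧-cong {h (x + y)} {h x H.∙ h y}
                (part-unique (part∈ (x + y)) (+-closed H (part∈ x) (part∈ y)) (rest (x + y))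
                  (resp K (solve 4 (λ x y u v → (x ⊞ ⊟ u) ⊞ (y ⊞ ⊟ v) ⊜ (x ⊞ y) ⊞ ⊟ (u ⊞ v)) refl x y (part x) (part y))
                    (+-closed K (rest x) (rest y)))
                  refl))
                (f.∙-homo (h x) (h y)) } ,
    record { isRelHomomorphism = record { cong = λ {a} {b} a≈b → f.injective {g a} {g b} (T.trans (f-g a) (T.trans a≈b (T.sym (f-g b)))) }
           ; homo = λ a b → f.injective {g (a T.∙ b)} {g a H.∙ g b}
               (T.trans (f-g (a T.∙ b)) (T.sym (T.trans (f.∙-homo (g a) (g b)) (T.∙-cong (f-g a) (f-g b))))) } ,
    λ a → T.trans (f.⟦⟧-cong {h (q a)} {g a}
      (part-unique (part∈ (q a)) (proj₂ (g a)) (rest (q a)) (resp K (sym (inverseʳ (q a))) (0∈ K)) refl)) (f-g a)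
    where
    module H = AbelianGroup (abelianGroup H)
    module f = GroupMorphisms.IsGroupIsomorphism f-iso

    part : Carrier → Carrier
    part x = proj₁ (decompose x)

    part∈ : ∀ x → part x ∈ H
    part∈ x = proj₁ (proj₂ (proj₂ (decompose x)))

    rest : ∀ x → x - part x ∈ K
    rest x with decompose x
    ... | u , k , _ , k∈K , x≈u+k = resp K
      (≈-from (sym x≈u+k) (solve 3 (λ x u k → k ⊞ x ⊜ (x ⊞ ⊟ u) ⊞ (u ⊞ k)) refl x u k)) k∈K

    part-unique : ∀ {x y u v} → u ∈ H → v ∈ H → x - u ∈ K → y - v ∈ K → x ≈ y → u ≈ v
    part-unique {x} {y} {u} {v} u∈H v∈H x-u∈K y-v∈K x≈y = x∙y⁻¹≈ε⇒x≈y u v (disjoint (u - v)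
      (difference-closed H u∈H v∈H)
      (resp K (≈-from (sym x≈y) (solve 4 (λ x y u v → (y ⊞ ⊟ v) ⊞ ⊟ (x ⊞ ⊟ u) ⊞ x ⊜ (u ⊞ ⊟ v) ⊞ y) refl x y u v))
        (difference-closed K y-v∈K x-u∈K)))

    h : Carrier → H.Carrier
    h x = part x , part∈ x

    p : Carrier → T.Carrier
    p x = f (h x)

    g : T.Carrier → H.Carrier
    g a = proj₁ (f.surjective a)

    f-g : ∀ a → f (g a) T.≈ a
    f-g a = proj₂ (f.surjective a) {g a} refl

    q : T.Carrier → Carrier
    q a = proj₁ (g a)

-- From direct summands to obstructions.

private
  module ℤ₂ = AbelianGroup (ℤ/ 2)

1≉0 : ¬ + 1 ℤ₂.≈ + 0
1≉0 2∣1 = contradiction (ℕ.∣⇒≤ (∣⇒∣ᵤ 2∣1)) λ { (ℕ.s≤s ()) }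

module _ {c ℓ} (G : AbelianGroup c ℓ) where

  open AbelianGroup G renaming (_∙_ to infixl 6 _+_; ε to 0#; _⁻¹ to -_)
  open Subgroup

  kernel : ∀ {χ} → MagmaHomomorphism G (ℤ/ 2) χ → Subgroup G
  kernel {χ} χ-homo = record
    { Member     = λ x → Lift (c ⊔ ℓ) (χ x ℤ₂.≈ + 0)
    ; resp       = λ {x} {y} x≈y (lift p) → lift (ℤ₂.trans {χ y} {χ x} {+ 0} (χ.cong (sym x≈y)) p)
    ; 0∈         = lift χ.ε-homo
    ; +-closed   = λ {x} {y} (lift p) (lift q) → lift (ℤ₂.trans {χ (x + y)} {χ x ℤ.+ χ y} {+ 0} (χ.homo x y) (ℤ₂.∙-cong {χ x} {+ 0} {χ y} {+ 0} p q))
    ; neg-closed = λ {x} (lift p) → lift (ℤ₂.trans {χ (- x)} {ℤ.- χ x} {+ 0} (χ.⁻¹-homo x) (ℤ₂.⁻¹-cong {χ x} {+ 0} p))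
    }
    where module χ = AdditiveMap G (ℤ/ 2) χ-homo

  1∉kernel : ∀ {χ} (χ-homo : MagmaHomomorphism G (ℤ/ 2) χ) {s} → χ s ℤ₂.≈ + 1 → ¬ Member (kernel χ-homo) s
  1∉kernel {χ} χ-homo {s} χs≈1 (lift χs≈0) = 1≉0 (ℤ₂.trans {+ 1} {χ s} {+ 0} (ℤ₂.sym {χ s} {+ 1} χs≈1) χs≈0)

  kernel-cosets : ∀ {χ} (χ-homo : MagmaHomomorphism G (ℤ/ 2) χ) {s} → χ s ℤ₂.≈ + 1 →
    ∀ g → Member (kernel χ-homo) g ⊎ Member (kernel χ-homo) (g - s)
  kernel-cosets {χ} χ-homo {s} χs≈1 g with parity (χ g)
  ... | j , inj₁ χg≡2j   = inj₁ (lift (divides j (≡.trans (ℤ.+-identityʳ (χ g)) (≡.trans χg≡2j (i+i≡i*2 j)))))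
  ... | j , inj₂ χg≡1+2j = inj₂ (lift (ℤ₂.trans {χ (g - s)} {χ g ℤ.- χ s} {+ 0} (χ.-‿homo g s)
        (ℤ₂.trans {χ g ℤ.- χ s} {χ g ℤ.- + 1} {+ 0} (ℤ₂.∙-congˡ {χ g} {ℤ.- χ s} {ℤ.- + 1} (ℤ₂.⁻¹-cong {χ s} {+ 1} χs≈1))
          (divides j (≡.trans (≡.cong (λ k → k ℤ.- + 1 ℤ.- + 0) χg≡1+2j) (reduce j))))))
    where
    module χ = AdditiveMap G (ℤ/ 2) χ-homo
    reduce : ∀ j → + 1 ℤ.+ (j ℤ.+ j) ℤ.- + 1 ℤ.- + 0 ≡ j ℤ.* + 2
    reduce = solve-∀

  module _ (T : AbelianGroup 0ℓ 0ℓ) where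

    private module T = AbelianGroup T

    -- The elements are carried into `G` along the inclusion `q` and the characters are pulled back
    -- along the retraction `p`; as p q is the identity, all values are kept.
    obstruction : HasDirectSummandIsomorphicTo G T → ∀ s t →
      s T.∙ s T.≈ t T.∙ t → ¬ s T.∙ s T.≈ T.ε → (s T.∙ s) T.∙ (s T.∙ s) T.≈ T.ε →
      ∀ {α β} → MagmaHomomorphism T (ℤ/ 2) α → MagmaHomomorphism T (ℤ/ 2) β →
      α s ℤ₂.≈ + 1 → α t ℤ₂.≈ + 0 → β s ℤ₂.≈ + 0 → β t ℤ₂.≈ + 1 → Obstruction G
    obstruction summand s t 2s≈2t 2s≉0 4s≈0 {α} {β} α-homo β-homo αs αt βs βt
      with DirectSummands.retraction G T summand
    ... | p , q , p-homo , q-homo , p-q = record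
      { s        = q s
      ; t        = q t
      ; 2s≈2t    = trans (sym (q.homo s s)) (trans (q.cong 2s≈2t) (q.homo t t))
      ; 2s≉0     = λ 2qs≈0 → 2s≉0 (T.trans (T.sym (T.trans (p.homo (q s) (q s)) (T.∙-cong (p-q s) (p-q s))))
                     (T.trans (p.cong 2qs≈0) p.ε-homo))
      ; 4s≈0     = trans (sym (trans (q.homo (s T.∙ s) (s T.∙ s)) (∙-cong (q.homo s s) (q.homo s s))))
                     (trans (q.cong 4s≈0) q.ε-homo)
      ; A        = kernel αp-homo
      ; B        = kernel βp-homo
      ; s∉A      = 1∉kernel αp-homo αps
      ; t∈A      = lift (ℤ₂.trans {α (p (q t))} {α t} {+ 0} (α.cong (p-q t)) αt)
      ; A-cosets = kernel-cosets αp-homo αps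
      ; s∈B      = lift (ℤ₂.trans {β (p (q s))} {β s} {+ 0} (β.cong (p-q s)) βs)
      ; t∉B      = 1∉kernel βp-homo βpt
      ; B-cosets = kernel-cosets βp-homo βpt
      }
      where
      module p = AdditiveMap G T p-homo
      module q = AdditiveMap T G q-homo
      module α = AdditiveMap T (ℤ/ 2) α-homo
      module β = AdditiveMap T (ℤ/ 2) β-homo
      αp-homo = isMagmaHomomorphism (λ {i} {j} {k} → ℤ₂.trans {i} {j} {k}) p-homo α-homo
      βp-homo = isMagmaHomomorphism (λ {i} {j} {k} → ℤ₂.trans {i} {j} {k}) p-homo β-homo
      αps : α (p (q s)) ℤ₂.≈ + 1
      αps = ℤ₂.trans {α (p (q s))} {α s} {+ 1} (α.cong (p-q s)) αs
      βpt : β (p (q t)) ℤ₂.≈ + 1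
      βpt = ℤ₂.trans {β (p (q t))} {β t} {+ 1} (β.cong (p-q t)) βt

private
  ∣-difference : ∀ n m → ∃[ q ] m ≡ q ℕ.* n → + n ∣ + m ℤ.- + 0
  ∣-difference n m (q , m≡qn) = divides (+ q) (≡.trans (ℤ.+-identityʳ (+ m)) (≡.trans (≡.cong +_ m≡qn) (ℤ.pos-* q n)))

  ∤-difference : ∀ n m → .{{ℕ.NonZero m}} → m ℕ.< n → ¬ + n ∣ + m ℤ.- + 0
  ∤-difference n m m<n n∣m = ℕ.<⇒≱ m<n (ℕ.∣⇒≤ (≡.subst (n ℕ.∣_) (ℕ.+-identityʳ m) (∣⇒∣ᵤ n∣m)))

-- Both (1 , 0) and (1 , 1) double to the involution (2 , 0). Their dual characters are x + y, well
-- defined modulo 2 because 2 divides 4, and y.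
obstruction-4-2 : ∀ {c ℓ} {G : AbelianGroup c ℓ} → HasDirectSummandIsomorphicTo G (ℤ/ 4 ⊕ ℤ/ 2) → Obstruction G
obstruction-4-2 {G = G} summand = obstruction G (ℤ/ 4 ⊕ ℤ/ 2) summand (+ 1 , + 0) (+ 1 , + 1)
  (divides (+ 0) ≡.refl , divides (ℤ.- + 1) ≡.refl)
  (λ (4∣2 , _) → ∤-difference 4 2 (ℕ.s≤s (ℕ.s≤s (ℕ.s≤s ℕ.z≤n))) 4∣2)
  (divides (+ 1) ≡.refl , divides (+ 0) ≡.refl)
  {λ (x , y) → x ℤ.+ y} {proj₂}
  (record { isRelHomomorphism = record { cong = λ { {x , y} {x′ , y′} (4∣x-x′ , 2∣y-y′) →
                ℤ₂.∙-cong {x} {x′} {y} {y′} (∣-trans (divides (+ 2) ≡.refl) 4∣x-x′) 2∣y-y′ } }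
          ; homo = λ (x , y) (x′ , y′) → ℤ₂.reflexive (interchange x y x′ y′) })
  (record { isRelHomomorphism = record { cong = proj₂ } ; homo = λ (x , y) (x′ , y′) → ℤ₂.refl {y ℤ.+ y′} })
  (divides (+ 0) ≡.refl) (divides (+ 1) ≡.refl) (divides (+ 0) ≡.refl) (divides (+ 0) ≡.refl)
  where
  interchange : ∀ x y x′ y′ → (x ℤ.+ x′) ℤ.+ (y ℤ.+ y′) ≡ (x ℤ.+ y) ℤ.+ (x′ ℤ.+ y′)
  interchange = solve-∀

-- For h = 2ⁿ⁻², a quarter of the order of the first factor, (h , 1 , 0) and (h , 0 , 1) both double
-- to the involution (2h , 0 , 0). The last two coordinates are the dual characters.
obstruction-2ⁿ-2-2 : ∀ {c ℓ} {G : AbelianGroup c ℓ} {n} → 3 ≤ n →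
  HasDirectSummandIsomorphicTo G (ℤ/ (2 ^ n) ⊕ ℤ/ 2 ⊕ ℤ/ 2) → Obstruction G
obstruction-2ⁿ-2-2 {G = G} {n} (ℕ.s≤s (ℕ.s≤s {n = suc m} (ℕ.s≤s ℕ.z≤n))) summand =
  obstruction G (ℤ/ (2 ^ n) ⊕ ℤ/ 2 ⊕ ℤ/ 2) summand (+ h , + 1 , + 0) (+ h , + 0 , + 1)
  (AbelianGroup.refl (ℤ/ (2 ^ n)) {+ (h ℕ.+ h)} , divides (+ 1) ≡.refl , divides (ℤ.- + 1) ≡.refl)
  (λ (2ⁿ∣2h , _) → ∤-difference (2 ^ n) (h ℕ.+ h) {{ℕ.>-nonZero 0<2h}}
    (≡.subst (h ℕ.+ h ℕ.<_) (≡.sym (quadruple h)) (ℕ.m<m+n (h ℕ.+ h) 0<2h)) 2ⁿ∣2h)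
  (∣-difference (2 ^ n) ((h ℕ.+ h) ℕ.+ (h ℕ.+ h)) (1 , ≡.trans (≡.sym (quadruple h)) (≡.sym (ℕ.*-identityˡ (2 ^ n)))) ,
    divides (+ 2) ≡.refl , divides (+ 0) ≡.refl)
  {λ (x , y , w) → y} {λ (x , y , w) → w}
  (record { isRelHomomorphism = record { cong = λ (_ , p , _) → p } ; homo = λ (_ , y , _) (_ , y′ , _) → ℤ₂.refl {y ℤ.+ y′} })
  (record { isRelHomomorphism = record { cong = λ (_ , _ , p) → p } ; homo = λ (_ , _ , w) (_ , _ , w′) → ℤ₂.refl {w ℤ.+ w′} })
  (divides (+ 0) ≡.refl) (divides (+ 0) ≡.refl) (divides (+ 0) ≡.refl) (divides (+ 0) ≡.refl)
  where
  h = 2 ^ suc m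

  quadruple : ∀ h → 2 ℕ.* (2 ℕ.* h) ≡ (h ℕ.+ h) ℕ.+ (h ℕ.+ h)
  quadruple = ℕ.solve-∀

  0<2h : 0 ℕ.< h ℕ.+ h
  0<2h = ℕ.<-≤-trans (ℕ.m^n>0 2 (suc m)) (ℕ.m≤m+n h h)

-- A colour-preserving automorphism that is not affine.

module NonCCA (em : ∀ {a} → ExcludedMiddle a) {c ℓ} (G : AbelianGroup c ℓ) (obs : Obstruction G) where

  open AbelianGroup G renaming (_∙_ to infixl 6 _+_; ε to 0#; _⁻¹ to -_)
  open AbelianGroupProperties G
  open IntegerMultiples G
  open SubgroupConstructions G
  open Subgroup
  open Obstruction obs

  private
    z : Carrier
    z = s + s

    z∈A : z ∈ A
    z∈A = resp A (sym 2s≈2t) (+-closed A t∈A t∈A)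

    z∈B : z ∈ B
    z∈B = +-closed B s∈B s∈B

    -- The product of the two characters with kernels A and B, with values in {0, z}.
    select : ∀ {P Q : Set (c ⊔ ℓ)} → Dec P → Dec Q → Carrier
    select (no _) (no _) = z
    select _      _      = 0#

    select-cong : ∀ {P Q P′ Q′} (d : Dec P) (e : Dec Q) (d′ : Dec P′) (e′ : Dec Q′) →
      (P → P′) → (P′ → P) → (Q → Q′) → (Q′ → Q) → select d e ≈ select d′ e′
    select-cong (yes _) _       (yes _)  _        _ _ _ _ = refl
    select-cong (yes p) _       (no ¬p′) _        f _ _ _ = contradiction (f p) ¬p′
    select-cong (no ¬p) _       (yes p′) _        _ f _ _ = contradiction (f p′) ¬p
    select-cong (no _)  (yes _) (no _)   (yes _)  _ _ _ _ = refl
    select-cong (no _)  (yes q) (no _)   (no ¬q′) _ _ f _ = contradiction (f q) ¬q′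
    select-cong (no _)  (no ¬q) (no _)   (yes q′) _ _ _ f = contradiction (f q′) ¬q
    select-cong (no _)  (no _)  (no _)   (no _)   _ _ _ _ = refl

    δ : Carrier → Carrier
    δ g = select (em {P = g ∈ A}) (em {P = g ∈ B})

    shift-∈ : ∀ K {x y} → y - x ∈ K → x ∈ K → y ∈ K
    shift-∈ K {x} {y} p q = resp K (solve 2 (λ x y → y ⊞ ⊟ x ⊞ x ⊜ y) refl x y) (+-closed K p q)

    unshift-∈ : ∀ K {x y} → y - x ∈ K → y ∈ K → x ∈ K
    unshift-∈ K {x} {y} p q = resp K (solve 2 (λ x y → y ⊞ ⊟ (y ⊞ ⊟ x) ⊜ x) refl x y) (difference-closed K q p)

    δ-invariant : ∀ {x y} → y - x ∈ A ∩ B → δ x ≈ δ y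
    δ-invariant (p , q) = select-cong em em em em (shift-∈ A p) (unshift-∈ A p) (shift-∈ B q) (unshift-∈ B q)

    δ-cong : ∀ {x y} → x ≈ y → δ x ≈ δ y
    δ-cong {x} {y} x≈y = δ-invariant (resp (A ∩ B) (sym (x≈y⇒x∙y⁻¹≈ε (sym x≈y))) (0∈ (A ∩ B)))

    δ-shift : ∀ g {x} → x ∈ A ∩ B → δ g ≈ δ (g + x)
    δ-shift g {x} x∈ = δ-invariant (resp (A ∩ B) (solve 2 (λ g x → x ⊜ g ⊞ x ⊞ ⊟ g) refl g x) x∈)

    δ-values : ∀ g → δ g ≈ 0# ⊎ δ g ≈ z
    δ-values g with em {P = g ∈ A} | em {P = g ∈ B}
    ... | yes _ | _     = inj₁ refl
    ... | no _  | yes _ = inj₁ refl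
    ... | no _  | no _  = inj₂ refl

    δ-A : ∀ {g} → g ∈ A → δ g ≈ 0#
    δ-A {g} g∈A with em {P = g ∈ A}
    ... | yes _  = refl
    ... | no g∉A = contradiction g∈A g∉A

    δ-B : ∀ {g} → g ∈ B → δ g ≈ 0#
    δ-B {g} g∈B with em {P = g ∈ A} | em {P = g ∈ B}
    ... | yes _ | _      = refl
    ... | no _  | yes _  = refl
    ... | no _  | no g∉B = contradiction g∈B g∉B

    δ-z : ∀ {g} → g ∉ A → g ∉ B → δ g ≈ z
    δ-z {g} g∉A g∉B with em {P = g ∈ A} | em {P = g ∈ B}
    ... | yes g∈A | _       = contradiction g∈A g∉A
    ... | no _    | yes g∈B = contradiction g∈B g∉B
    ... | no _    | no _    = refl

    δ∈ : ∀ g → δ g ∈ A ∩ B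
    δ∈ g with δ-values g
    ... | inj₁ δg≈0 = resp (A ∩ B) (sym δg≈0) (0∈ (A ∩ B))
    ... | inj₂ δg≈z = resp (A ∩ B) (sym δg≈z) (z∈A , z∈B)

    2δ≈0 : ∀ g → δ g + δ g ≈ 0#
    2δ≈0 g with δ-values g
    ... | inj₁ δg≈0 = trans (∙-cong δg≈0 δg≈0) (identityˡ 0#)
    ... | inj₂ δg≈z = trans (∙-cong δg≈z δg≈z) 4s≈0

    φ : Carrier → Carrier
    φ g = g + δ g

    φ-cong : ∀ {x y} → x ≈ y → φ x ≈ φ y
    φ-cong x≈y = ∙-cong x≈y (δ-cong x≈y)

    φ-involutive : ∀ g → φ (φ g) ≈ g
    φ-involutive g = ≈-from (∙-cong (sym (δ-shift g (δ∈ g))) (2δ≈0 g))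
      (solve 3 (λ g d d′ → g ⊞ d ⊞ d′ ⊞ (d ⊞ 𝟘) ⊜ g ⊞ (d′ ⊞ (d ⊞ d))) refl g (δ g) (δ (φ g)))

  S : ConnectionSet G
  S = record
    { Member     = λ x → Lift c (x + x ≈ z) ⊎ x ∈ A ∩ B
    ; resp       = λ { x≈y (inj₁ (lift 2x≈z)) → inj₁ (lift (trans (∙-cong (sym x≈y) (sym x≈y)) 2x≈z))
                     ; x≈y (inj₂ x∈)          → inj₂ (resp (A ∩ B) x≈y x∈) }
    ; neg-closed = λ { {x} (inj₁ (lift 2x≈z)) → inj₁ (lift (≈-from (trans (sym 4s≈0) (∙-congʳ (sym 2x≈z)))
                         (solve 2 (λ x z → ⊟ x ⊞ ⊟ x ⊞ (x ⊞ x ⊞ z) ⊜ z ⊞ 𝟘) refl x z)))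
                     ; (inj₂ x∈)              → inj₂ (neg-closed (A ∩ B) x∈) }
    }

  open ConnectionSet S using () renaming (Member to S-Member; neg-closed to S-neg-closed)
  open Graph (Cay G S) using (Adjacent; adj-resp)

  private
    -- Along an element of A ∩ B, `δ` does not change. If 2x = z, a change of `δ` by z along `x` is
    -- harmless: 2z = 0 gives x + z = x - 2x = - x.
    φ-step : ∀ g x → S-Member x → φ (g + x) ≈ φ g + x ⊎ φ (g + x) ≈ φ g - x
    φ-step g x (inj₂ x∈) = inj₁ (≈-from (sym (δ-shift g x∈))
      (solve 4 (λ g x d d′ → g ⊞ x ⊞ d′ ⊞ d ⊜ g ⊞ d ⊞ x ⊞ d′) refl g x (δ g) (δ (g + x))))
    φ-step g x (inj₁ (lift 2x≈z)) = by-values (δ-values g) (δ-values (g + x))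
      where
      fixed : δ (g + x) ≈ δ g → φ (g + x) ≈ φ g + x
      fixed p = ≈-from p (solve 4 (λ g x d d′ → g ⊞ x ⊞ d′ ⊞ d ⊜ g ⊞ d ⊞ x ⊞ d′) refl g x (δ g) (δ (g + x)))

      flipped : x + x + δ (g + x) ≈ δ g → φ (g + x) ≈ φ g - x
      flipped p = ≈-from p (solve 4 (λ g x d d′ → g ⊞ x ⊞ d′ ⊞ d ⊜ g ⊞ d ⊞ ⊟ x ⊞ (x ⊞ x ⊞ d′)) refl g x (δ g) (δ (g + x)))

      by-values : δ g ≈ 0# ⊎ δ g ≈ z → δ (g + x) ≈ 0# ⊎ δ (g + x) ≈ z → φ (g + x) ≈ φ g + x ⊎ φ (g + x) ≈ φ g - x
      by-values (inj₁ p) (inj₁ q) = inj₁ (fixed (trans q (sym p)))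
      by-values (inj₂ p) (inj₂ q) = inj₁ (fixed (trans q (sym p)))
      by-values (inj₁ p) (inj₂ q) = inj₂ (flipped (trans (∙-cong 2x≈z q) (trans 4s≈0 (sym p))))
      by-values (inj₂ p) (inj₁ q) = inj₂ (flipped (trans (∙-cong 2x≈z q) (trans (identityʳ z) (sym p))))

    adjacent-φ : ∀ {g h} → Adjacent g h → Adjacent (φ g) (φ h)
    adjacent-φ {g} (x , x∈S , h≈g+x) with φ-step g x x∈S
    ... | inj₁ p = x , x∈S , trans (φ-cong h≈g+x) p
    ... | inj₂ p = - x , S-neg-closed x∈S , trans (φ-cong h≈g+x) p

  automorphism : Automorphism (Cay G S)
  automorphism = record
    { bijection = record
      { to        = φ
      ; cong      = φ-cong
      ; bijective = (λ {x} {y} φx≈φy → trans (sym (φ-involutive x)) (trans (φ-cong φx≈φy) (φ-involutive y)))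
                  , λ y → φ y , λ x≈φy → trans (φ-cong x≈φy) (φ-involutive y)
      }
    ; adjacency = λ g h → mk⇔ adjacent-φ λ adj →
        proj₁ adj-resp (φ-involutive h) (proj₂ adj-resp (φ-involutive g) (adjacent-φ adj))
    }

  colourPreserving : ColourPreserving G S automorphism
  colourPreserving = φ-step

  -- Subtracting `s`, `t` or both from h - g, as the cosets demand, leaves an element of A ∩ B, and
  -- all three kinds of step are in `S`.
  connected : Connected (Cay G S)
  connected g h = h , walk , refl
    where
    ∈S-s : S-Member s
    ∈S-s = inj₁ (lift refl)

    ∈S-t : S-Member t
    ∈S-t = inj₁ (lift (sym 2s≈2t))

    walk : Star Adjacent g h
    walk with A-cosets (h - g)
    ... | inj₁ p with B-cosets (h - g)
    ...   | inj₁ q = (h - g , inj₂ (p , q) , solve 2 (λ g h → h ⊜ g ⊞ (h ⊞ ⊟ g)) refl g h) ◅ ε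
    ...   | inj₂ q = (t , ∈S-t , refl) ◅
                     (h - g - t , inj₂ (difference-closed A p t∈A , q) , solve 3 (λ g h t → h ⊜ g ⊞ t ⊞ (h ⊞ ⊟ g ⊞ ⊟ t)) refl g h t) ◅ ε
    walk | inj₂ p with B-cosets (h - g - s)
    ...   | inj₁ q = (s , ∈S-s , refl) ◅
                     (h - g - s , inj₂ (p , q) , solve 3 (λ g h s → h ⊜ g ⊞ s ⊞ (h ⊞ ⊟ g ⊞ ⊟ s)) refl g h s) ◅ ε
    ...   | inj₂ q = (s , ∈S-s , refl) ◅ (t , ∈S-t , refl) ◅
                     (h - g - s - t , inj₂ (difference-closed A p t∈A , q) ,
                      solve 4 (λ g h s t → h ⊜ g ⊞ s ⊞ t ⊞ (h ⊞ ⊟ g ⊞ ⊟ s ⊞ ⊟ t)) refl g h s t) ◅ ε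

  -- As `φ` fixes 0, `s` and `t`, an affine `φ` would fix s + t; but there both characters are
  -- nonzero, and `φ` adds z.
  ¬affine : ¬ Affine G φ
  ¬affine (τ , b , τ-iso , φ≈) = 2s≉0 (≈-from additive
    (solve 3 (λ s t z → z ⊞ (s ⊞ t) ⊜ 𝟘 ⊞ (s ⊞ t ⊞ z)) refl s t z))
    where
    module τ = GroupMorphisms.IsGroupIsomorphism τ-iso

    ∉-+ : ∀ K {x y} → x ∉ K → y ∈ K → x + y ∉ K
    ∉-+ K {x} {y} x∉K y∈K p = x∉K (resp K (solve 2 (λ x y → x ⊞ y ⊞ ⊟ y ⊜ x) refl x y) (difference-closed K p y∈K))

    φ-0 : φ 0# ≈ 0#
    φ-0 = trans (∙-congˡ (δ-A (0∈ A))) (identityˡ 0#)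

    φ-s : φ s ≈ s
    φ-s = trans (∙-congˡ (δ-B s∈B)) (identityʳ s)

    φ-t : φ t ≈ t
    φ-t = trans (∙-congˡ (δ-A t∈A)) (identityʳ t)

    φ-s+t : φ (s + t) ≈ s + t + z
    φ-s+t = ∙-congˡ (δ-z (∉-+ A s∉A t∈A) (λ p → ∉-+ B t∉B s∈B (resp B (comm s t) p)))

    b≈0 : b ≈ 0#
    b≈0 = trans (sym (trans (φ≈ 0#) (trans (∙-congʳ τ.ε-homo) (identityˡ b)))) φ-0

    τ≈φ : ∀ x → τ x ≈ φ x
    τ≈φ x = sym (trans (φ≈ x) (trans (∙-congˡ b≈0) (identityʳ (τ x))))

    additive : s + t + z ≈ s + t
    additive = trans (sym φ-s+t) (trans (sym (τ≈φ (s + t)))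
      (trans (τ.∙-homo s t) (∙-cong (trans (τ≈φ s) φ-s) (trans (τ≈φ t) φ-t))))

  ¬cca : ¬ CCA G S
  ¬cca cca = ¬affine (cca automorphism colourPreserving)

-- From obstructions to direct summands.

module SummandFromObstruction (em : ∀ {a} → ExcludedMiddle a) {c ℓ} (G : AbelianGroup c ℓ)
                              (fg : FinitelyGenerated G) (obs : Obstruction G) where

  open AbelianGroup G renaming (_∙_ to infixl 6 _+_; ε to 0#; _⁻¹ to -_)
  open AbelianGroupProperties G
  open IntegerMultiples G
  open SubgroupConstructions G
  open CyclicSummands em G
  open DirectSummands G
  open Subgroup
  open Obstruction obs

  private
    xs : List Carrier
    xs = proj₁ (spanned fg)

    all∈ : ∀ x → x ∈ span xs
    all∈ = proj₂ (spanned fg)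

    ∣-0 : ∀ {n k} → n ∣ k → n ∣ k ℤ.- + 0
    ∣-0 {n} {k} = ≡.subst (n ∣_) (≡.sym (ℤ.+-identityʳ k))

    ∣⇒·≈0 : ∀ {n k x} → n · x ≈ 0# → n ∣ k → k · x ≈ 0#
    ∣⇒·≈0 {n} {x = x} nx≈0 (divides q ≡.refl) = trans (·-assoc q n x) (trans (·-congˡ q nx≈0) (·-zeroʳ q))

    ·-hom : ∀ n {x} → + n · x ≈ 0# → MagmaHomomorphism (ℤ/ n) G (_· x)
    ·-hom n {x} nx≈0 = record
      { isRelHomomorphism = record { cong = λ {j} {k} n∣j-k → x∙y⁻¹≈ε⇒x≈y (j · x) (k · x)
          (trans (sym (trans (·-distribʳ-+ j (ℤ.- k) x) (∙-congˡ (·-negˡ k x)))) (∣⇒·≈0 nx≈0 n∣j-k)) }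
      ; homo = λ j k → ·-distribʳ-+ j k x
      }

    ⊕-hom : ∀ (T U : AbelianGroup 0ℓ 0ℓ) {f g} → MagmaHomomorphism T G f → MagmaHomomorphism U G g →
              MagmaHomomorphism (T ⊕ U) G (λ (a , b) → f a + g b)
    ⊕-hom T U {f} {g} f-homo g-homo = record
      { isRelHomomorphism = record { cong = λ (p , q) → ∙-cong (f.cong p) (g.cong q) }
      ; homo = λ (a , b) (a′ , b′) → trans (∙-cong (f.homo a a′) (g.homo b b′))
          (solve 4 (λ u u′ v v′ → u ⊞ u′ ⊞ (v ⊞ v′) ⊜ u ⊞ v ⊞ (u′ ⊞ v′)) refl (f a) (f a′) (g b) (g b′))
      }
      where
      module f = AdditiveMap T G f-homo
      module g = AdditiveMap U G g-homo

    subtract : ∀ K {x y u} → y ∈ K → x - u ∈ K → x - (u - y) ∈ K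
    subtract K {x} {y} {u} y∈K p = resp K
      (solve 3 (λ x u y → x ⊞ ⊟ u ⊞ y ⊜ x ⊞ ⊟ (u ⊞ ⊟ y)) refl x u y) (+-closed K p y∈K)

    ∉-- : ∀ K {x y} → x ∉ K → y ∈ K → x - y ∉ K
    ∉-- K {x} {y} x∉K y∈K p = x∉K (resp K (solve 2 (λ x y → x ⊞ ⊟ y ⊞ y ⊜ x) refl x y) (+-closed K p y∈K))

    two-cosets : ∀ K {u e} → (∀ g → g ∈ K ⊎ g - u ∈ K) → (∀ {x} → x - u ∈ K → x - e ∈ K) → ∀ g → g ∈ adjoin K e
    two-cosets K {e = e} cosets u⇒e g with cosets g
    ... | inj₁ g∈K   = ⊆-adjoin K e g∈K
    ... | inj₂ g-u∈K = + 1 , resp K (∙-congˡ (⁻¹-cong (sym (1· e)))) (u⇒e g-u∈K)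

    -- Modulo `A`, the double of any element is 0 or 2s, and 2s = 2t lies in `A` because `t` does.
    2x∈A : ∀ x → x + x ∈ A
    2x∈A x with A-cosets x
    ... | inj₁ x∈A   = +-closed A x∈A x∈A
    ... | inj₂ x-s∈A = resp A (≈-from (sym 2s≈2t) (solve 3 (λ x s t → x ⊞ ⊟ s ⊞ (x ⊞ ⊟ s) ⊞ (t ⊞ t) ⊞ (s ⊞ s) ⊜ x ⊞ x ⊞ (t ⊞ t)) refl x s t))
      (+-closed A (+-closed A x-s∈A x-s∈A) (+-closed A t∈A t∈A))

    2x∈B : ∀ x → x + x ∈ B
    2x∈B x with B-cosets x
    ... | inj₁ x∈B   = +-closed B x∈B x∈B
    ... | inj₂ x-t∈B = resp B (≈-from 2s≈2t (solve 3 (λ x s t → x ⊞ ⊟ t ⊞ (x ⊞ ⊟ t) ⊞ (s ⊞ s) ⊞ (t ⊞ t) ⊜ x ⊞ x ⊞ (s ⊞ s)) refl x s t))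
      (+-closed B (+-closed B x-t∈B x-t∈B) (+-closed B s∈B s∈B))

    4t≈0 : (t + t) + (t + t) ≈ 0#
    4t≈0 = trans (∙-cong (sym 2s≈2t) (sym 2s≈2t)) 4s≈0

    2∣ : ∀ K {e} → e + e ≈ 0# → e ∉ K → ∀ k → k · e ∈ K → + 2 ∣ k
    2∣ K {e} e+e≈0 e∉K = 2^∣ K 0 e (trans (∙-cong (1· e) (1· e)) e+e≈0) (λ p → e∉K (resp K (1· e) p))

    2·≈0 : ∀ {x} → x + x ≈ 0# → + 2 · x ≈ 0#
    2·≈0 {x} = trans (2· x)

  -- The involution s - t lies outside `A`, while `t` lies in `A`. So reducing by s - t modulo `A`,
  -- then by `t` modulo `K`, ends in K ∩ A; the coefficients of a relation vanish in the same order.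
  summand-4-2 : t + t ∉ multiples (+ 4) → HasDirectSummandIsomorphicTo G (ℤ/ 4 ⊕ ℤ/ 2)
  summand-4-2 2t∉4G with complement xs all∈ 1 t (trans (∙-cong (2· t) (2· t)) 4t≈0) (λ p → 2t∉4G (resp (multiples (+ 4)) (2· t) p))
  ... | K , 2t∉K , all∈K+t = directSummand (ℤ/ 4 ⊕ ℤ/ 2) (⊕-hom (ℤ/ 4) (ℤ/ 2) {_· t} {_· e} (·-hom 4 4·t≈0) (·-hom 2 (2·≈0 e+e≈0))) (K ∩ A) cover disjoint
    where
    e = s - t

    4·t≈0 : + 4 · t ≈ 0#
    4·t≈0 = trans (solve 1 (λ t → t ⊞ (t ⊞ (t ⊞ (t ⊞ 𝟘))) ⊜ t ⊞ t ⊞ (t ⊞ t)) refl t) 4t≈0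

    e+e≈0 : e + e ≈ 0#
    e+e≈0 = ≈-from 2s≈2t (solve 2 (λ s t → s ⊞ ⊟ t ⊞ (s ⊞ ⊟ t) ⊞ (t ⊞ t) ⊜ 𝟘 ⊞ (s ⊞ s)) refl s t)

    cover : ∀ g → ∃[ a ] g - (proj₁ a · t + proj₂ a · e) ∈ K ∩ A
    cover g with two-cosets A A-cosets (subtract A t∈A) g
    ... | k , g-ke∈A with all∈K+t (g - k · e)
    ...   | j , p = (j , k) , resp (K ∩ A) (solve 3 (λ g u v → g ⊞ ⊟ v ⊞ ⊟ u ⊜ g ⊞ ⊟ (u ⊞ v)) refl g (j · t) (k · e))
      (p , difference-closed A g-ke∈A (·-closed A j t∈A))

    disjoint : ∀ a → proj₁ a · t + proj₂ a · e ∈ K ∩ A → + 4 ∣ proj₁ a ℤ.- + 0 × + 2 ∣ proj₂ a ℤ.- + 0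
    disjoint (j , k) (p , q) = ∣-0 (2^∣ K 1 t (trans (∙-cong (2· t) (2· t)) 4t≈0) 2t∉K j jt∈K) , ∣-0 2∣k
      where
      2∣k : + 2 ∣ k
      2∣k = 2∣ A e+e≈0 (∉-- A s∉A t∈A) k (resp A (solve 2 (λ u v → u ⊞ v ⊞ ⊟ u ⊜ v) refl (j · t) (k · e))
        (difference-closed A q (·-closed A j t∈A)))

      jt∈K : j · t ∈ K
      jt∈K = resp K (trans (∙-congˡ (∣⇒·≈0 (2·≈0 e+e≈0) 2∣k)) (identityʳ (j · t))) p

  module _ (n : ℕ) (w : Carrier) (2t≈2ⁿw : t + t ≈ 2^ (suc (suc n)) · w) where

    private
      -- The exponent is shifted by two, so `w₀`, a half of 2t, is still a double. Hence it lies in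
      -- A ∩ B, and subtracting it turns `s` and `t` into involutions without changing their cosets.
      w₀ e f : Carrier
      w₀ = 2^ (suc n) · w
      e  = s - w₀
      f  = t - w₀

      2w₀≈2t : w₀ + w₀ ≈ t + t
      2w₀≈2t = trans (sym (·-distribˡ-+ (2^ (suc n)) w w)) (trans (sym (2^-suc (suc n) w)) (sym 2t≈2ⁿw))

      w₀∈A : w₀ ∈ A
      w₀∈A = resp A (sym (2^-suc n w)) (·-closed A (2^ n) (2x∈A w))

      w₀∈B : w₀ ∈ B
      w₀∈B = resp B (sym (2^-suc n w)) (·-closed B (2^ n) (2x∈B w))

      2⟨x-w₀⟩≈0 : ∀ {x} → x + x ≈ t + t → (x - w₀) + (x - w₀) ≈ 0#
      2⟨x-w₀⟩≈0 {x} 2x≈2t = ≈-from (trans 2x≈2t (sym 2w₀≈2t))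
        (solve 2 (λ x w → x ⊞ ⊟ w ⊞ (x ⊞ ⊟ w) ⊞ (w ⊞ w) ⊜ 𝟘 ⊞ (x ⊞ x)) refl x w₀)

      e+e≈0 : e + e ≈ 0#
      e+e≈0 = 2⟨x-w₀⟩≈0 2s≈2t

      f+f≈0 : f + f ≈ 0#
      f+f≈0 = 2⟨x-w₀⟩≈0 refl

      e∈B : e ∈ B
      e∈B = difference-closed B s∈B w₀∈B

      f∈A : f ∈ A
      f∈A = difference-closed A t∈A w₀∈A

      decompose-AB : ∀ g → ∃[ k ] ∃[ l ] g - k · e - l · f ∈ A ∩ B
      decompose-AB g =
        let k , p = two-cosets A A-cosets (subtract A w₀∈A) g
            l , q = two-cosets B B-cosets (subtract B w₀∈B) (g - k · e)
        in k , l , difference-closed A p (·-closed A l f∈A) , q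

      2k·≈0 : ∀ k {x} → x + x ≈ 0# → k · x + k · x ≈ 0#
      2k·≈0 k {x} 2x≈0 = trans (sym (·-distribˡ-+ k x x)) (trans (·-congˡ k 2x≈0) (·-zeroʳ k))

      -- Multiples of the involutions `e` and `f` can be subtracted from `w` without changing 2w,
      -- hence without changing 2ⁿ⁺² w.
      adjust : ∃[ w′ ] (w′ ∈ A ∩ B × 2^ (suc (suc n)) · w′ ≈ t + t)
      adjust =
        let k , l , p = decompose-AB w
            w′ = w - k · e - l · f

            same-double : w′ + w′ ≈ w + w
            same-double = ≈-from (sym (trans (∙-cong (2k·≈0 k e+e≈0) (2k·≈0 l f+f≈0)) (identityˡ 0#)))
              (solve 3 (λ w u v → w ⊞ ⊟ u ⊞ ⊟ v ⊞ (w ⊞ ⊟ u ⊞ ⊟ v) ⊞ (u ⊞ u ⊞ (v ⊞ v)) ⊜ w ⊞ w ⊞ 𝟘) refl w (k · e) (l · f))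
        in w′ , p , trans (2^-suc (suc n) w′)
             (trans (·-congˡ (2^ (suc n)) same-double) (trans (sym (2^-suc (suc n) w)) (sym 2t≈2ⁿw)))

    -- In a relation, `A` controls the coefficient of `e` and `B` that of `f`, because each contains
    -- the other two generators; what remains is a multiple of `w′` in `K`.
    summand-from : ∀ w′ → w′ ∈ A ∩ B → 2^ (suc (suc n)) · w′ + 2^ (suc (suc n)) · w′ ≈ 0# →
      ∃[ K ] (2^ (suc (suc n)) · w′ ∉ K × (∀ x → x ∈ adjoin K w′)) →
      HasDirectSummandIsomorphicTo G (ℤ/ (2 ^ suc (suc (suc n))) ⊕ ℤ/ 2 ⊕ ℤ/ 2)
    summand-from w′ w′∈ 2·2^w′≈0 (K , z∉K , all∈K+w′) = directSummand (ℤ/ (2 ^ suc (suc (suc n))) ⊕ ℤ/ 2 ⊕ ℤ/ 2)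
      {ψ} (⊕-hom (ℤ/ (2 ^ suc (suc (suc n)))) (ℤ/ 2 ⊕ ℤ/ 2) {_· w′} {λ (k , l) → k · e + l · f} (·-hom (2 ^ suc (suc (suc n))) order)
        (⊕-hom (ℤ/ 2) (ℤ/ 2) {_· e} {_· f} (·-hom 2 (2·≈0 e+e≈0)) (·-hom 2 (2·≈0 f+f≈0))))
      (K ∩ A ∩ B) cover disjoint
      where
      order : 2^ (suc (suc (suc n))) · w′ ≈ 0#
      order = trans (2^-suc (suc (suc n)) w′) (trans (·-distribˡ-+ (2^ (suc (suc n))) w′ w′) 2·2^w′≈0)

      ψ : ℤ × ℤ × ℤ → Carrier
      ψ (j , k , l) = j · w′ + (k · e + l · f)

      cover : ∀ g → ∃[ a ] g - ψ a ∈ K ∩ A ∩ B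
      cover g =
        let k , l , p = decompose-AB g
            j , q     = all∈K+w′ (g - k · e - l · f)
        in (j , k , l) , resp (K ∩ A ∩ B)
             (solve 4 (λ g u v x → g ⊞ ⊟ u ⊞ ⊟ v ⊞ ⊟ x ⊜ g ⊞ ⊟ (x ⊞ (u ⊞ v))) refl g (k · e) (l · f) (j · w′))
             (q , difference-closed (A ∩ B) p (·-closed (A ∩ B) j w′∈))

      disjoint : ∀ a → ψ a ∈ K ∩ A ∩ B →
        2^ (suc (suc (suc n))) ∣ proj₁ a ℤ.- + 0 × + 2 ∣ proj₁ (proj₂ a) ℤ.- + 0 × + 2 ∣ proj₂ (proj₂ a) ℤ.- + 0
      disjoint (j , k , l) (p , q , r) = ∣-0 (2^∣ K (suc (suc n)) w′ 2·2^w′≈0 z∉K j jw′∈K) , ∣-0 2∣k , ∣-0 2∣l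
        where
        2∣k : + 2 ∣ k
        2∣k = 2∣ A e+e≈0 (∉-- A s∉A w₀∈A) k
          (resp A (solve 3 (λ u v x → u ⊞ (v ⊞ x) ⊞ ⊟ (u ⊞ x) ⊜ v) refl (j · w′) (k · e) (l · f))
            (difference-closed A q (+-closed A (·-closed A j (proj₁ w′∈)) (·-closed A l f∈A))))

        2∣l : + 2 ∣ l
        2∣l = 2∣ B f+f≈0 (∉-- B t∉B w₀∈B) l
          (resp B (solve 3 (λ u v x → u ⊞ (v ⊞ x) ⊞ ⊟ (u ⊞ v) ⊜ x) refl (j · w′) (k · e) (l · f))
            (difference-closed B r (+-closed B (·-closed B j (proj₂ w′∈)) (·-closed B k e∈B))))

        jw′∈K : j · w′ ∈ K
        jw′∈K = resp K (trans (∙-congˡ (trans (∙-cong (∣⇒·≈0 (2·≈0 e+e≈0) 2∣k) (∣⇒·≈0 (2·≈0 f+f≈0) 2∣l)) (identityˡ 0#)))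
          (identityʳ (j · w′))) p

    summand-2ⁿ-2-2 : t + t ∉ multiples (2^ (suc (suc (suc n)))) →
      HasDirectSummandIsomorphicTo G (ℤ/ (2 ^ suc (suc (suc n))) ⊕ ℤ/ 2 ⊕ ℤ/ 2)
    summand-2ⁿ-2-2 2t∉ = summand-from w′ w′∈ 2·2^w′≈0
      (complement xs all∈ (suc (suc n)) w′ 2·2^w′≈0 (λ p → 2t∉ (resp (multiples (2^ (suc (suc (suc n))))) 2^w′ p)))
      where
      w′ = proj₁ adjust
      w′∈ = proj₁ (proj₂ adjust)
      2^w′ = proj₂ (proj₂ adjust)

      2·2^w′≈0 : 2^ (suc (suc n)) · w′ + 2^ (suc (suc n)) · w′ ≈ 0#
      2·2^w′≈0 = trans (∙-cong 2^w′ 2^w′) 4t≈0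

  summand : HasDirectSummandIsomorphicTo G (ℤ/ 4 ⊕ ℤ/ 2)
          ⊎ ∃[ n ] (3 ≤ n × HasDirectSummandIsomorphicTo G (ℤ/ (2 ^ n) ⊕ ℤ/ 2 ⊕ ℤ/ 2))
  summand with height xs all∈ (t + t) 4t≈0 (λ 2t≈0 → 2s≉0 (trans 2s≈2t 2t≈0))
  ... | zero , _ , 2t∉2G = contradiction (t , sym (2· t)) 2t∉2G
  ... | suc zero , _ , 2t∉4G = inj₁ (summand-4-2 2t∉4G)
  ... | suc (suc n) , (w , 2t≈) , 2t∉ = inj₂ (suc (suc (suc n)) , ℕ.s≤s (ℕ.s≤s (ℕ.s≤s ℕ.z≤n)) , summand-2ⁿ-2-2 n w 2t≈ 2t∉)

-- Classical principles.

module Classical (em : ∀ {a} → ExcludedMiddle a) where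

  stable : ∀ {a} {P : Set a} → ¬ ¬ P → P
  stable {P = P} ¬¬p with em {P = P}
  ... | yes p = p
  ... | no ¬p = contradiction ¬p ¬¬p

  least : ∀ {p} {P : ℕ → Set p} {n} → P n → ∃[ m ] (P m × (∀ {k} → k ℕ.< m → ¬ P k))
  least {P = P} = go (<-wellFounded _)
    where
    go : ∀ {n} → Acc ℕ._<_ n → P n → ∃[ m ] (P m × (∀ {k} → k ℕ.< m → ¬ P k))
    go {n} (acc smaller) pn with em {P = ∃[ k ] (k ℕ.< n × P k)}
    ... | yes (k , k<n , pk) = go (smaller k<n) pk
    ... | no ∄               = n , pn , λ k<n pk → ∄ (_ , k<n , pk)

-- Finiteness of the set of involutions.

module Involutions (em : ∀ {a} → ExcludedMiddle a) (G : AbelianGroup c ℓ) where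

  open AbelianGroup G renaming (_∙_ to infixl 6 _+_; ε to 0#; _⁻¹ to -_)
  open AbelianGroupProperties G
  open IntegerMultiples G
  open SubgroupConstructions G
  open Classical em
  open Subgroup

  -- Take an involution e in K + ⟨ x ⟩ but not in K with the least coefficient of x;
  -- division with remainder leaves at most the two cosets K and e + K for the others.
  involution-cosets : ∀ K x {e} → e ∈ adjoin K x → e + e ≈ 0# → e ∉ K →
    ∃[ e ] (e + e ≈ 0# × (∀ {g} → g ∈ adjoin K x → g + g ≈ 0# → g ∈ K ⊎ g - e ∈ K))
  involution-cosets K x {e} (k , e-kx∈K) e+e≈0 e∉K =
    from-least (let n , p = positive k {e} e-kx∈K e+e≈0 e∉K in least {P = P} {n} p)
    where
    P : ℕ → Set _
    P n = ∃[ e ] (e - + n · x ∈ K × e + e ≈ 0# × e ∉ K)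

    positive : ∀ k {e} → e - k · x ∈ K → e + e ≈ 0# → e ∉ K → ∃[ n ] P n
    positive (+ n)    {e} e-kx∈K e+e≈0 e∉K = n , e , e-kx∈K , e+e≈0 , e∉K
    positive -[1+ n ] {e} e-kx∈K e+e≈0 e∉K = suc n , - e ,
      resp K (solve 2 (λ e u → ⊟ (e ⊞ ⊟ (⊟ u)) ⊜ ⊟ e ⊞ ⊟ u) refl e (+ suc n · x)) (neg-closed K e-kx∈K) ,
      trans (⁻¹-∙-comm e e) (trans (⁻¹-cong e+e≈0) ε⁻¹≈ε) ,
      λ -e∈K → e∉K (resp K (⁻¹-involutive e) (neg-closed K -e∈K))

    from-least : ∃[ n ] (P n × (∀ {m} → m ℕ.< n → ¬ P m)) →
      ∃[ e ] (e + e ≈ 0# × (∀ {g} → g ∈ adjoin K x → g + g ≈ 0# → g ∈ K ⊎ g - e ∈ K))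
    from-least (zero , (e , p , _ , e∉K) , _) = contradiction (resp K (solve 1 (λ e → e ⊞ ⊟ 𝟘 ⊜ e) refl e) p) e∉K
    from-least (n@(suc _) , (e , e-nx∈K , e+e≈0 , _) , minimal) = e , e+e≈0 , cosets
      where
      cosets : ∀ {g} → g ∈ adjoin K x → g + g ≈ 0# → g ∈ K ⊎ g - e ∈ K
      cosets {g} (k , g-kx∈K) g+g≈0 = by-parity (parity q)
        where
        q = k ℤ./ℕ n
        r = k ℤ.%ℕ n

        kx≈ : k · x ≈ + r · x + q · + n · x
        kx≈ = trans (·-congʳ x (ℤ.a≡a%ℕn+[a/ℕn]*n k n))
          (trans (·-distribʳ-+ (+ r) (q ℤ.* + n) x) (∙-congˡ (·-assoc q (+ n) x)))

        2qe≈0 : q · e + q · e ≈ 0#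
        2qe≈0 = trans (sym (·-distribˡ-+ q e e)) (trans (·-congˡ q e+e≈0) (·-zeroʳ q))

        g-qe∈K : g - q · e ∈ K
        g-qe∈K = stable λ g-qe∉K → minimal (ℤ.n%ℕd<d k n)
          ( g - q · e
          , resp K (≈-from (sym (∙-cong kx≈ (·-distribˡ-- q e (+ n · x))))
              (solve 6 (λ g u v w y d → g ⊞ ⊟ u ⊞ ⊟ d ⊞ (u ⊞ d) ⊜ g ⊞ ⊟ y ⊞ ⊟ v ⊞ (v ⊞ w ⊞ (y ⊞ ⊟ w))) refl
                g (k · x) (+ r · x) (q · + n · x) (q · e) (q · (e - + n · x))))
              (difference-closed K g-kx∈K (·-closed K q e-nx∈K))
          , ≈-from (∙-cong g+g≈0 (sym 2qe≈0)) (solve 2 (λ g y → g ⊞ ⊟ y ⊞ (g ⊞ ⊟ y) ⊞ (𝟘 ⊞ (y ⊞ y)) ⊜ 𝟘 ⊞ (g ⊞ g ⊞ 𝟘)) refl g (q · e))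
          , g-qe∉K )

        by-parity : ∃[ j ] (q ≡ j ℤ.+ j ⊎ q ≡ + 1 ℤ.+ (j ℤ.+ j)) → g ∈ K ⊎ g - e ∈ K
        by-parity (j , inj₁ q≡) = inj₁ (resp K
          (trans (∙-congˡ (⁻¹-cong (trans (·-congʳ e q≡) (trans (double-· j e) (trans (·-congˡ j e+e≈0) (·-zeroʳ j))))))
            (solve 1 (λ g → g ⊞ ⊟ 𝟘 ⊜ g) refl g)) g-qe∈K)
        by-parity (j , inj₂ q≡) = inj₂ (resp K (∙-congˡ (⁻¹-cong (trans (·-congʳ e q≡) (odd-· j e+e≈0)))) g-qe∈K)

  -- A new generator at most doubles the list: by `involution-cosets` the new involutions lie in a
  -- single coset of the old span, and subtracting the involution `e` leads back to listed ones.
  finitely-many : ∀ xs → ∃[ es ] (∀ {g} → g ∈ span xs → g + g ≈ 0# → Any (g ≈_) es)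
  finitely-many [] = 0# ∷ [] , λ (lift g≈0) _ → here g≈0
  finitely-many (x ∷ xs) with finitely-many xs | em {P = ∃[ e ] (e ∈ span (x ∷ xs) × e + e ≈ 0# × e ∉ span xs)}
  ... | es , listed | no ∄ = es , λ {g} g∈ g+g≈0 → listed {g} (stable λ g∉ → ∄ (g , g∈ , g+g≈0 , g∉)) g+g≈0
  ... | es , listed | yes (e₀ , e₀∈ , e₀+e₀≈0 , e₀∉) with involution-cosets (span xs) x {e₀} e₀∈ e₀+e₀≈0 e₀∉
  ...   | e , e+e≈0 , cosets = es ++ map (_+_ e) es , listed′
    where
    listed′ : ∀ {g} → g ∈ span (x ∷ xs) → g + g ≈ 0# → Any (g ≈_) (es ++ map (_+_ e) es)
    listed′ {g} g∈ g+g≈0 with cosets {g} g∈ g+g≈0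
    ... | inj₁ g∈K   = Any.++⁺ˡ (listed {g} g∈K g+g≈0)
    ... | inj₂ g-e∈K = Any.++⁺ʳ es (Any.map⁺ (Any.map
      (λ {y} g-e≈y → ≈-from g-e≈y (solve 3 (λ g e y → g ⊞ y ⊜ e ⊞ y ⊞ (g ⊞ ⊟ e)) refl g e y))
      (listed {g - e} g-e∈K (≈-from (trans g+g≈0 (sym e+e≈0)) (solve 2 (λ g e → g ⊞ ⊟ e ⊞ (g ⊞ ⊟ e) ⊞ (e ⊞ e) ⊜ 𝟘 ⊞ (g ⊞ g)) refl g e)))))

  repetition : FinitelyGenerated G → ∀ (f : ℕ → Carrier) → (∀ n → f n + f n ≈ 0#) → ∃[ i ] ∃[ j ] (i ℕ.< j × f i ≈ f j)
  repetition fg f f+f≈0 =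
    let i , j , i<j , same = pigeonhole (ℕ.n<1+n (length es)) (λ i → Any.index (position (toℕ i)))
    in toℕ i , toℕ j , i<j ,
       trans (Any.lookup-index (position (toℕ i)))
         (trans (reflexive (≡.cong (List.lookup es) same)) (sym (Any.lookup-index (position (toℕ j)))))
    where
    xs = proj₁ (spanned fg)
    es = proj₁ (finitely-many xs)

    position : ∀ n → Any (f n ≈_) es
    position n = proj₂ (finitely-many xs) {f n} (proj₂ (spanned fg) (f n)) (f+f≈0 n)

-- Colour-permuting automorphisms are affine, or yield an obstruction.

module ColourPermutingAutomorphisms (em : ∀ {a} → ExcludedMiddle a) {c ℓ} (G : AbelianGroup c ℓ) (fg : FinitelyGenerated G)
  (S : ConnectionSet G) (connected : Connected (Cay G S))
  (automorphism : Automorphism (Cay G S)) (permuting : ColourPermuting G S automorphism) where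

  open AbelianGroup G renaming (_∙_ to infixl 6 _+_; ε to 0#; _⁻¹ to -_)
  open AbelianGroupProperties G
  open IntegerMultiples G
  open SubgroupConstructions G
  open SubgroupExtension em G
  open Involutions em G
  open Classical em
  open Subgroup
  open ConnectionSet S using (elements) renaming (Member to S-Member; resp to S-resp)
  open Graph (Cay G S) using (Adjacent)

  private
    Colour : Set (c ⊔ ℓ)
    Colour = Σ[ s ∈ Carrier ] S-Member s

    module φ = Bijection (Automorphism.bijection automorphism)
    module π = Bijection (proj₁ permuting)

    φ : Carrier → Carrier
    φ = φ.to

    image : Colour → Carrier
    image σ = proj₁ (π.to σ)

    Δ : Carrier → Carrier → Carrier
    Δ x g = φ (g + x) - φ g

    Δ-cong : ∀ {x y g h} → x ≈ y → g ≈ h → Δ x g ≈ Δ y h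
    Δ-cong x≈y g≈h = ∙-cong (φ.cong (∙-cong g≈h x≈y)) (⁻¹-cong (φ.cong g≈h))

    Δ-+ : ∀ x y g → Δ (x + y) g ≈ Δ y (g + x) + Δ x g
    Δ-+ x y g = ≈-from (φ.cong (sym (assoc g x y)))
      (solve 4 (λ p q r s → p ⊞ ⊟ r ⊞ q ⊜ q ⊞ ⊟ s ⊞ (s ⊞ ⊟ r) ⊞ p) refl (φ (g + (x + y))) (φ (g + x + y)) (φ g) (φ (g + x)))

    Δ-comm : ∀ x y g → Δ y (g + x) + Δ x g ≈ Δ x (g + y) + Δ y g
    Δ-comm x y g = trans (sym (Δ-+ x y g)) (trans (Δ-cong (comm x y) refl) (Δ-+ y x g))

    Δ≈0 : ∀ x g → Δ x g ≈ 0# → x ≈ 0#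
    Δ≈0 x g Δ≈0 = ∙-cancelˡ g x 0# (trans (φ.injective (x∙y⁻¹≈ε⇒x≈y _ _ Δ≈0)) (sym (identityʳ g)))

    Δ-determines : ∀ x y g → Δ x g ≈ Δ y g → x ≈ y
    Δ-determines x y g Δx≈Δy = ∙-cancelˡ g x y (φ.injective (∙-cancelʳ (- φ g) _ _ Δx≈Δy))

    Δ-values : ∀ (σ : Colour) g → Δ (proj₁ σ) g ≈ image σ ⊎ Δ (proj₁ σ) g ≈ - image σ
    Δ-values σ g with proj₂ permuting g σ
    ... | inj₁ p = inj₁ (≈-from p (solve 3 (λ a b r → a ⊞ ⊟ b ⊞ (b ⊞ r) ⊜ r ⊞ a) refl (φ (g + proj₁ σ)) (φ g) (image σ)))
    ... | inj₂ p = inj₂ (≈-from p (solve 3 (λ a b r → a ⊞ ⊟ b ⊞ (b ⊞ ⊟ r) ⊜ ⊟ r ⊞ a) refl (φ (g + proj₁ σ)) (φ g) (image σ)))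

    equal-or-opposite : ∀ (σ : Colour) g h → Δ (proj₁ σ) g ≈ Δ (proj₁ σ) h ⊎ Δ (proj₁ σ) g + Δ (proj₁ σ) h ≈ 0#
    equal-or-opposite σ g h with Δ-values σ g | Δ-values σ h
    ... | inj₁ p | inj₁ q = inj₁ (trans p (sym q))
    ... | inj₁ p | inj₂ q = inj₂ (trans (∙-cong p q) (inverseʳ _))
    ... | inj₂ p | inj₁ q = inj₂ (trans (∙-cong p q) (inverseˡ _))
    ... | inj₂ p | inj₂ q = inj₁ (trans p (sym q))

    -- If the steps by s at g and at g + s were opposite, `φ` would take the same value at g and at
    -- g + 2s, against injectivity.
    Δ-along : ∀ (σ : Colour) → ¬ proj₁ σ + proj₁ σ ≈ 0# → ∀ g → Δ (proj₁ σ) (g + proj₁ σ) ≈ Δ (proj₁ σ) g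
    Δ-along σ@(s , _) 2s≉0 g with equal-or-opposite σ (g + s) g
    ... | inj₁ p = p
    ... | inj₂ p = contradiction (Δ≈0 (s + s) g (trans (Δ-+ s s g) p)) 2s≉0

    Δ-double : ∀ (σ : Colour) → ¬ proj₁ σ + proj₁ σ ≈ 0# → ∀ g → Δ (proj₁ σ + proj₁ σ) g ≈ Δ (proj₁ σ) g + Δ (proj₁ σ) g
    Δ-double σ@(s , _) 2s≉0 g = trans (Δ-+ s s g) (∙-congʳ (Δ-along σ 2s≉0 g))

    2Δ≈0 : ∀ (σ : Colour) → image σ + image σ ≈ 0# → ∀ g → Δ (proj₁ σ) g + Δ (proj₁ σ) g ≈ 0#
    2Δ≈0 σ 2r≈0 g with Δ-values σ g
    ... | inj₁ p = trans (∙-cong p p) 2r≈0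
    ... | inj₂ p = trans (∙-cong p p) (trans (⁻¹-∙-comm _ _) (trans (⁻¹-cong 2r≈0) ε⁻¹≈ε))

    -- If 2s ≠ 0, then Δ (2s) = 2 Δ s = ± 2 π(s) = 0, and injectivity of `φ` gives 2s = 0 after all.
    involution-reflected : ∀ (σ : Colour) → image σ + image σ ≈ 0# → proj₁ σ + proj₁ σ ≈ 0#
    involution-reflected σ@(s , _) 2r≈0 = stable λ 2s≉0 →
      2s≉0 (Δ≈0 (s + s) 0# (trans (Δ-double σ 2s≉0 0#) (2Δ≈0 σ 2r≈0 0#)))

    π⁻¹ : Colour → Colour
    π⁻¹ σ = proj₁ (π.surjective σ)

    image-π⁻¹ : ∀ σ → image (π⁻¹ σ) ≈ proj₁ σ
    image-π⁻¹ σ = proj₂ (π.surjective σ) {π⁻¹ σ} refl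

    -- π⁻¹ maps the involutions in S to themselves, injectively; there are finitely
    -- many of them, so it permutes them, and so does π.
    involution-preserved : ∀ (σ : Colour) → proj₁ σ + proj₁ σ ≈ 0# → image σ + image σ ≈ 0#
    involution-preserved σ 2s≈0 =
      let i , j , i<j , p = repetition fg (λ n → proj₁ (preimages n)) involutive in periodic i j i<j p
      where
      preimages : ℕ → Colour
      preimages zero    = σ
      preimages (suc n) = π⁻¹ (preimages n)

      involutive : ∀ n → proj₁ (preimages n) + proj₁ (preimages n) ≈ 0#
      involutive zero    = 2s≈0
      involutive (suc n) = involution-reflected (preimages (suc n))
        (trans (∙-cong (image-π⁻¹ (preimages n)) (image-π⁻¹ (preimages n))) (involutive n))

      periodic : ∀ i j → i ℕ.< j → proj₁ (preimages i) ≈ proj₁ (preimages j) → image σ + image σ ≈ 0#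
      -- If `σ` recurs among its iterated preimages, then π(σ) is the iterate just before the
      -- recurrence, an involution. Any other coincidence is moved back to this one by applying π.
      periodic zero    (suc j) _           p = trans (∙-cong image≈ image≈) (involutive j)
        where image≈ = trans (π.cong {σ} {preimages (suc j)} p) (image-π⁻¹ (preimages j))
      periodic (suc i) (suc j) (ℕ.s≤s i<j) p = periodic i j i<j
        (trans (sym (image-π⁻¹ (preimages i))) (trans (π.cong {preimages (suc i)} {preimages (suc j)} p) (image-π⁻¹ (preimages j))))

  connected-induction : ∀ K → (∀ {s} → S-Member s → s ∈ K) → ∀ x → x ∈ K
  connected-induction K S⊆K x with connected 0# x
  ... | x′ , path , x′≈x = resp K x′≈x (along path (0∈ K))
    where
    along : ∀ {g h} → Star Adjacent g h → g ∈ K → h ∈ K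
    along ε                         g∈K = g∈K
    along ((s , s∈S , h≈g+s) ◅ path) g∈K = along path (resp K (sym h≈g+s) (+-closed K g∈K (S⊆K s∈S)))

  private
    L : Subgroup G
    L = record
      { Member     = λ x → ∀ g h → Δ x g ≈ Δ x h
      ; resp       = λ x≈y Δx g h → trans (Δ-cong (sym x≈y) refl) (trans (Δx g h) (Δ-cong x≈y refl))
      ; 0∈         = λ g h → trans (Δ-0 g) (sym (Δ-0 h))
      ; +-closed   = λ {x} {y} Δx Δy g h → trans (Δ-+ x y g) (trans (∙-cong (Δy (g + x) (h + x)) (Δx g h)) (sym (Δ-+ x y h)))
      ; neg-closed = λ {x} Δx g h → trans (Δ-neg x g) (trans (⁻¹-cong (Δx (g - x) (h - x))) (sym (Δ-neg x h)))
      }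
      where
      Δ-0 : ∀ g → Δ 0# g ≈ 0#
      Δ-0 g = trans (∙-congʳ (φ.cong (identityʳ g))) (inverseʳ (φ g))

      Δ-neg : ∀ x g → Δ (- x) g ≈ - Δ x (g - x)
      Δ-neg x g = inverseʳ-unique (Δ x (g - x)) (Δ (- x) g) (trans (sym (Δ-+ (- x) x g)) (trans (Δ-cong (inverseˡ x) refl) (Δ-0 g)))

    -- The square at g forces Δ t (g + s) = e - 2d, which must be ± e. As 2d ≠ 0, it is - e, so 2d =
    -- 2e; `Δ-double` and injectivity transfer this to 2s = 2t.
    module Change (σ τ : Colour) (g : Carrier) where

      s t d e : Carrier
      s = proj₁ σ
      t = proj₁ τ
      d = Δ s g
      e = Δ t g

      module _ (change : ¬ Δ s (g + t) ≈ d) where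

        Δs[g+t] : Δ s (g + t) ≈ - d
        Δs[g+t] with equal-or-opposite σ (g + t) g
        ... | inj₁ p = contradiction p change
        ... | inj₂ p = inverseˡ-unique _ _ p

        2d≉0 : ¬ d + d ≈ 0#
        2d≉0 2d≈0 = change (trans Δs[g+t] (sym (inverseˡ-unique d d 2d≈0)))

        Δt[g+s] : Δ t (g + s) ≈ e - d - d
        Δt[g+s] = ≈-from (trans (Δ-comm s t g) (∙-congʳ Δs[g+t]))
          (solve 3 (λ d e u → u ⊞ (⊟ d ⊞ e) ⊜ e ⊞ ⊟ d ⊞ ⊟ d ⊞ (u ⊞ d)) refl d e (Δ t (g + s)))

        2d≈2e : d + d ≈ e + e
        2d≈2e with equal-or-opposite τ (g + s) g
        ... | inj₁ p = contradiction (≈-from (trans (sym p) Δt[g+s]) (solve 2 (λ d e → d ⊞ d ⊞ (e ⊞ ⊟ d ⊞ ⊟ d) ⊜ 𝟘 ⊞ e) refl d e)) 2d≉0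
        ... | inj₂ p = ≈-from (trans (sym p) (∙-congʳ Δt[g+s])) (solve 2 (λ d e → d ⊞ d ⊞ (e ⊞ ⊟ d ⊞ ⊟ d ⊞ e) ⊜ e ⊞ e ⊞ 𝟘) refl d e)

        Δt[g+s]≈-e : Δ t (g + s) ≈ - e
        Δt[g+s]≈-e = trans Δt[g+s] (≈-from (sym 2d≈2e) (solve 2 (λ d e → e ⊞ ⊟ d ⊞ ⊟ d ⊞ (d ⊞ d) ⊜ ⊟ e ⊞ (e ⊞ e)) refl d e))

        2s≉0 : ¬ s + s ≈ 0#
        2s≉0 2s≈0 = 2d≉0 (2Δ≈0 σ (involution-preserved σ 2s≈0) g)

        2t≉0 : ¬ t + t ≈ 0#
        2t≉0 2t≈0 = 2d≉0 (trans 2d≈2e (2Δ≈0 τ (involution-preserved τ 2t≈0) g))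

        2s≈2t : s + s ≈ t + t
        2s≈2t = Δ-determines (s + s) (t + t) g (trans (Δ-double σ 2s≉0 g) (trans 2d≈2e (sym (Δ-double τ 2t≉0 g))))

        -- Compare the two ways around the square at g - t, where Δ s = - d because g + t = g - t + 2s.
        4d≈0 : (d + d) + (d + d) ≈ 0#
        4d≈0 = ≈-from (∙-cong 2d≈2e (sym around))
          (solve 2 (λ d e → d ⊞ d ⊞ (d ⊞ d) ⊞ (e ⊞ e ⊞ (⊟ e ⊞ ⊟ d)) ⊜ 𝟘 ⊞ (d ⊞ d ⊞ (d ⊞ e))) refl d e)
          where
          Δs[g-t] : Δ s (g - t) ≈ - d
          Δs[g-t] = trans (sym (Δ-along σ 2s≉0 (g - t))) (trans (sym (Δ-along σ 2s≉0 (g - t + s)))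
            (trans (Δ-cong refl (≈-from 2s≈2t (solve 3 (λ g s t → g ⊞ ⊟ t ⊞ s ⊞ s ⊞ (t ⊞ t) ⊜ g ⊞ t ⊞ (s ⊞ s)) refl g s t))) Δs[g+t]))

          Δt[g-t] : Δ t (g - t) ≈ e
          Δt[g-t] = trans (sym (Δ-along τ 2t≉0 (g - t))) (Δ-cong refl (solve 2 (λ g t → g ⊞ ⊟ t ⊞ t ⊜ g) refl g t))

          Δt[g-t+s] : Δ t (g - t + s) ≈ - e
          Δt[g-t+s] = trans (sym (Δ-along τ 2t≉0 (g - t + s)))
            (trans (Δ-cong refl (solve 3 (λ g s t → g ⊞ ⊟ t ⊞ s ⊞ t ⊜ g ⊞ s) refl g s t)) Δt[g+s]≈-e)

          Δs[g-t+t] : Δ s (g - t + t) ≈ d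
          Δs[g-t+t] = Δ-cong refl (solve 2 (λ g t → g ⊞ ⊟ t ⊞ t ⊜ g) refl g t)

          around : - e - d ≈ d + e
          around = trans (∙-cong (sym Δt[g-t+s]) (sym Δs[g-t])) (trans (Δ-comm s t (g - t)) (∙-cong Δs[g-t+t] Δt[g-t]))

        4s≈0 : (s + s) + (s + s) ≈ 0#
        4s≈0 = Δ≈0 _ g (trans (Δ-+ (s + s) (s + s) g) (trans (∙-cong (Δ-double σ 2s≉0 (g + (s + s))) (Δ-double σ 2s≉0 g))
          (trans (∙-congʳ (∙-cong back back)) 4d≈0)))
          where
          back : Δ s (g + (s + s)) ≈ d
          back = trans (Δ-cong refl (sym (assoc g s s))) (trans (Δ-along σ 2s≉0 (g + s)) (Δ-along σ 2s≉0 g))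

        s∉L : s ∉ L
        s∉L s∈L = change (s∈L (g + t) g)

        t∉L : t ∉ L
        t∉L t∈L = 2d≉0 (trans 2d≈2e (≈-from (trans (t∈L g (g + s)) Δt[g+s]≈-e) (solve 1 (λ e → e ⊞ e ⊞ ⊟ e ⊜ 𝟘 ⊞ e) refl e)))

        -- Δ (s - t) is d - e at g + t and - d - e at g + 2t; the two differ by 2d.
        s-t∉L : s - t ∉ L
        s-t∉L s-t∈L = 2d≉0 (≈-from (trans (sym p) (trans (s-t∈L (g + t) (g + t + t)) q))
          (solve 2 (λ d e → d ⊞ d ⊞ (⊟ d ⊞ ⊟ e) ⊜ 𝟘 ⊞ (d ⊞ ⊟ e)) refl d e))
          where
          split : ∀ h → Δ s h ≈ Δ (s - t) (h + t) + Δ t h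
          split h = trans (Δ-cong (solve 2 (λ s t → s ⊜ t ⊞ (s ⊞ ⊟ t)) refl s t) refl) (Δ-+ t (s - t) h)

          p : Δ (s - t) (g + t) ≈ d - e
          p = ≈-from (sym (split g)) (solve 3 (λ u d e → u ⊞ d ⊜ d ⊞ ⊟ e ⊞ (u ⊞ e)) refl (Δ (s - t) (g + t)) d e)

          q : Δ (s - t) (g + t + t) ≈ - d - e
          q = ≈-from (trans (∙-congˡ (sym (Δ-along τ 2t≉0 g))) (trans (sym (split (g + t))) Δs[g+t]))
            (solve 3 (λ u d e → u ⊞ ⊟ d ⊜ ⊟ d ⊞ ⊟ e ⊞ (u ⊞ e)) refl (Δ (s - t) (g + t + t)) d e)

    -- The periods of Δ s form a subgroup. If no colour changed Δ s, it would contain `S`, hence be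
    -- all of `G`, and Δ s would be constant.
    changing : ∀ (σ : Colour) → proj₁ σ ∉ L → ∃[ τ ] ∃[ g ] ¬ Δ (proj₁ σ) (g + proj₁ τ) ≈ Δ (proj₁ σ) g
    changing (s , _) s∉L = stable λ ∄ → s∉L λ g h →
      trans (sym (connected-induction periods (λ {t} t∈S g → stable λ change → ∄ ((t , t∈S) , g , change)) (h - g) g))
            (Δ-cong refl (solve 2 (λ g h → g ⊞ (h ⊞ ⊟ g) ⊜ h) refl g h))
      where
      periods : Subgroup G
      periods = record
        { Member     = λ x → ∀ g → Δ s (g + x) ≈ Δ s g
        ; resp       = λ x≈y p g → trans (Δ-cong refl (∙-congˡ (sym x≈y))) (p g)
        ; 0∈         = λ g → Δ-cong refl (identityʳ g)
        ; +-closed   = λ {x} {y} p q g → trans (Δ-cong refl (sym (assoc g x y))) (trans (q (g + x)) (p g))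
        ; neg-closed = λ {x} p g → trans (sym (p (g - x))) (Δ-cong refl (solve 2 (λ g x → g ⊞ ⊟ x ⊞ x ⊜ g) refl g x))
        }

    -- It suffices to treat colours. For s outside `L`, Δ (2s) only takes the values ± 2d, and these
    -- coincide because 4d = 0.
    2x∈L : ∀ x → x + x ∈ L
    2x∈L = connected-induction doubles λ {s} s∈S → 2s∈L (s , s∈S)
      where
      doubles : Subgroup G
      doubles = record
        { Member     = λ x → x + x ∈ L
        ; resp       = λ x≈y → resp L (∙-cong x≈y x≈y)
        ; 0∈         = +-closed L (0∈ L) (0∈ L)
        ; +-closed   = λ {x} {y} p q → resp L (solve 2 (λ x y → x ⊞ x ⊞ (y ⊞ y) ⊜ x ⊞ y ⊞ (x ⊞ y)) refl x y) (+-closed L p q)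
        ; neg-closed = λ {x} p → resp L (solve 1 (λ x → ⊟ (x ⊞ x) ⊜ ⊟ x ⊞ ⊟ x) refl x) (neg-closed L p)
        }

      2s∈L : ∀ (σ : Colour) → proj₁ σ + proj₁ σ ∈ L
      2s∈L σ@(s , _) with em {P = s ∈ L}
      ... | yes s∈L = +-closed L s∈L s∈L
      ... | no s∉L with changing σ s∉L
      ...   | τ , g , change = λ h h′ → trans (constant h) (sym (constant h′))
        where
        open Change σ τ g using (d; 2s≉0; 4d≈0)
        constant : ∀ h → Δ (s + s) h ≈ d + d
        constant h with equal-or-opposite σ h g
        ... | inj₁ p = trans (Δ-double σ (2s≉0 change) h) (∙-cong p p)
        ... | inj₂ p = trans (Δ-double σ (2s≉0 change) h) (≈-from (trans (trans (∙-cong p p) (identityˡ 0#)) (sym (4d≈0 change)))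
          (solve 2 (λ u d → u ⊞ u ⊞ (d ⊞ d ⊞ (d ⊞ d)) ⊜ d ⊞ d ⊞ (u ⊞ d ⊞ (u ⊞ d))) refl (Δ s h) d))

    from-change : ∀ (σ τ : Colour) g → ¬ Δ (proj₁ σ) (g + proj₁ τ) ≈ Δ (proj₁ σ) g → Obstruction G
    from-change σ τ g change = assemble (separating s t (s∉L change) (s-t∉L change)) (separating t s (t∉L change)
      (λ t-s∈L → s-t∉L change (resp L (solve 2 (λ s t → ⊟ (t ⊞ ⊟ s) ⊜ s ⊞ ⊟ t) refl s t) (neg-closed L t-s∈L))))
      where
      open Change σ τ g

      -- These subgroups are the kernels of the dual characters. Since doubles lie in `L`, a
      -- multiple of `y` is 0 or `y` modulo `L`, so `x` stays outside L + ⟨ y ⟩ and `maximal`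
      -- applies with m = 2.
      separating : ∀ x y → x ∉ L → x - y ∉ L → ∃[ K ] (adjoin L y ⊆ K × x ∉ K × (∀ g → g + g ∈ K → g ∈ K ⊎ g - x ∈ K))
      separating x y x∉L x-y∉L = maximal 2 (proj₁ (spanned fg)) (proj₂ (spanned fg)) x (adjoin L y) x∉L+y
        (λ g → ⊆-adjoin L y (resp L (sym (2· g)) (2x∈L g)))
        where
        x∉L+y : x ∉ adjoin L y
        x∉L+y (k , x-ky∈L) with parity k
        ... | j , inj₁ ≡.refl = x∉L (resp L (≈-from (sym (double-· j y))
          (solve 3 (λ x u v → x ⊞ ⊟ u ⊞ v ⊞ u ⊜ x ⊞ v) refl x ((j ℤ.+ j) · y) (j · (y + y))))
          (+-closed L x-ky∈L (·-closed L j (2x∈L y))))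
        ... | j , inj₂ ≡.refl = x-y∉L (resp L (≈-from (sym (odd-expansion j y))
          (solve 4 (λ x y u v → x ⊞ ⊟ u ⊞ v ⊞ u ⊜ x ⊞ ⊟ y ⊞ (y ⊞ v)) refl x y ((+ 1 ℤ.+ (j ℤ.+ j)) · y) (j · (y + y))))
          (+-closed L x-ky∈L (·-closed L j (2x∈L y))))

      assemble : ∃[ A ] (adjoin L t ⊆ A × s ∉ A × (∀ g → g + g ∈ A → g ∈ A ⊎ g - s ∈ A)) →
                 ∃[ B ] (adjoin L s ⊆ B × t ∉ B × (∀ g → g + g ∈ B → g ∈ B ⊎ g - t ∈ B)) → Obstruction G
      assemble (A , ⊆A , s∉A , A-cosets) (B , ⊆B , t∉B , B-cosets) = record
        { s = s ; t = t
        ; 2s≈2t = 2s≈2t change ; 2s≉0 = 2s≉0 change ; 4s≈0 = 4s≈0 change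
        ; A = A ; B = B
        ; s∉A = s∉A ; t∈A = ⊆A (∈-adjoin L t) ; A-cosets = λ g → A-cosets g (⊆A (⊆-adjoin L t (2x∈L g)))
        ; s∈B = ⊆B (∈-adjoin L s) ; t∉B = t∉B ; B-cosets = λ g → B-cosets g (⊆B (⊆-adjoin L s (2x∈L g)))
        }

    -- Once Δ y does not depend on the base point, the cocycle rule `Δ-+` becomes additivity of x ↦
    -- Δ x 0.
    affine : (∀ x → x ∈ L) → Affine G φ
    affine all∈L = (λ x → Δ x 0#) , φ 0# , record
      { isGroupMonomorphism = record
        { isGroupHomomorphism = record
          { isMonoidHomomorphism = record
            { isMagmaHomomorphism = τ-homo
            ; ε-homo = τ.ε-homo
            }
          ; ⁻¹-homo = τ.⁻¹-homo
          }
        ; injective = λ {x} {y} → Δ-determines x y 0#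
        }
      ; surjective = λ y → proj₁ (φ.surjective (y + φ 0#)) , λ {x} x≈ →
          ≈-from (proj₂ (φ.surjective (y + φ 0#)) (trans (identityˡ x) x≈))
            (solve 3 (λ u v y → u ⊞ ⊟ v ⊞ (y ⊞ v) ⊜ y ⊞ u) refl (φ (0# + x)) (φ 0#) y)
      } , λ x → ≈-from (φ.cong (sym (identityˡ x))) (solve 3 (λ u u′ v → u ⊞ u′ ⊜ u′ ⊞ ⊟ v ⊞ v ⊞ u) refl (φ x) (φ (0# + x)) (φ 0#))
      where
      τ-homo : MagmaHomomorphism G G (λ x → Δ x 0#)
      τ-homo = record
        { isRelHomomorphism = record { cong = λ x≈y → Δ-cong x≈y refl }
        ; homo = λ x y → trans (Δ-+ x y 0#) (trans (comm _ _) (∙-congˡ (all∈L y (0# + x) 0#)))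
        }
      module τ = AdditiveMap G G τ-homo

  affine-or-obstruction : Affine G φ ⊎ Obstruction G
  affine-or-obstruction with em {P = Σ[ σ ∈ Colour ] proj₁ σ ∉ L}
  ... | yes (σ , s∉L) = inj₂ (let τ , g , change = changing σ s∉L in from-change σ τ g change)
  ... | no ∄          = inj₁ (affine (connected-induction L λ {s} s∈S → stable λ s∉L → ∄ ((s , s∈S) , s∉L)))

-- The equivalences, each passing through obstructions.

corollary1p10 : (∀ {a} → ExcludedMiddle a) →
    ∀ {c ℓ} (G : AbelianGroup c ℓ) → FinitelyGenerated G →
    let
      i   = ∃[ S ] (Connected (Cay G S) × ¬ CCA G S)
      ii  = ∃[ S ] (Connected (Cay G S) × ¬ StronglyCCA G S)
      iii = HasDirectSummandIsomorphicTo G (ℤ/ 4 ⊕ ℤ/ 2)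
          ⊎ ∃[ n ] (3 ≤ n × HasDirectSummandIsomorphicTo G (ℤ/ (2 ^ n) ⊕ ℤ/ 2 ⊕ ℤ/ 2))
    in (i ⇔ ii) × (ii ⇔ iii)
corollary1p10 em G fg =
    mk⇔ i⇒ii (λ p → obstruction⇒i (ii⇒obstruction p))
  , mk⇔ (λ p → SummandFromObstruction.summand em G fg (ii⇒obstruction p)) (λ p → i⇒ii (obstruction⇒i (iii⇒obstruction p)))
  where
  i⇒ii : ∃[ S ] (Connected (Cay G S) × ¬ CCA G S) → ∃[ S ] (Connected (Cay G S) × ¬ StronglyCCA G S)
  i⇒ii (S , connected , ¬cca) = S , connected , λ scca → ¬cca λ φ preserving →
    scca φ (Identity.bijection (ConnectionSet.elements S) , λ g (s , s∈S) → preserving g s s∈S)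

  -- The failure of the strong CCA property is a bare negation and exhibits no automorphism, so the
  -- argument is by contradiction: without an obstruction every colour-permuting automorphism would
  -- be affine.
  ii⇒obstruction : ∃[ S ] (Connected (Cay G S) × ¬ StronglyCCA G S) → Obstruction G
  ii⇒obstruction (S , connected , ¬scca) = Classical.stable em λ ¬obstruction → ¬scca λ φ permuting →
    fromInj₁ (λ obs → contradiction obs ¬obstruction)
      (ColourPermutingAutomorphisms.affine-or-obstruction em G fg S connected φ permuting)

  iii⇒obstruction : HasDirectSummandIsomorphicTo G (ℤ/ 4 ⊕ ℤ/ 2)
    ⊎ ∃[ n ] (3 ≤ n × HasDirectSummandIsomorphicTo G (ℤ/ (2 ^ n) ⊕ ℤ/ 2 ⊕ ℤ/ 2)) → Obstruction G
  iii⇒obstruction (inj₁ summand)           = obstruction-4-2 summand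
  iii⇒obstruction (inj₂ (n , 3≤n , summand)) = obstruction-2ⁿ-2-2 3≤n summand

  obstruction⇒i : Obstruction G → ∃[ S ] (Connected (Cay G S) × ¬ CCA G S)
  obstruction⇒i obs = S , connected , ¬cca
    where open NonCCA em G obs
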